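{- Let $G$ be a finite simple $3$-regular circle graph. Then $G$ has at least two disjoint pairs of twin vertices.
   Context: All graphs are finite and simple. A double occurrence word is a finite sequence in which each letter that appears, appears exactly twice. The interlacement graph $\mathcal{I}(W)$ of a double occurrence word $W$ has one vertex for each letter of $W$, and two vertices $a,b$ are adjacent if and only if the corresponding letters appear in $W$ in the order $abab$ or $baba$ (as a subsequence). A circle graph is a simple graph isomorphic to the interlacement graph of some double occurrence word. Two distinct vertices $v_1,v_2$ of $G$ are twins if they have the same neighbors outside $\{v_1,v_2\}$ (they may or may not be adjacent to each other). -}

module Defs where

open import Data.Nat using (ℕ)
open import Data.Bool using (Bool; true; false; T)
open import Data.Fin using (Fin)
open import Data.Nat using () renaming (_≟_ to _≟ℕ_)
open import Data.List using (List; []; _∷_; length; filter; allFin)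
open import Data.List.Membership.Propositional using (_∈_)
open import Data.List.Relation.Binary.Sublist.Propositional using (_⊆_)
open import Data.Sum using (_⊎_)
open import Data.Product using (_×_; Σ; ∃-syntax)
open import Function.Definitions using (Injective)
open import Relation.Binary.PropositionalEquality using (_≡_; _≢_)
open import Relation.Nullary.Decidable.Core using (T?)

record SimpleGraph (n : ℕ) : Set where
  field
    adj    : Fin n → Fin n → Bool
    sym    : ∀ u v → adj u v ≡ adj v u
    irrefl : ∀ v → adj v v ≡ false
open SimpleGraph public

degree : ∀ {n} → SimpleGraph n → Fin n → ℕ
degree G v = length (filter (λ u → T? (adj G v u)) (allFin _))

Regular : ∀ {n} → ℕ → SimpleGraph n → Set
Regular k G = ∀ v → degree G v ≡ k

occ : ℕ → List ℕ → ℕ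
occ x W = length (filter (λ y → y ≟ℕ x) W)

DoubleOccurrence : List ℕ → Set
DoubleOccurrence W = ∀ x → x ∈ W → occ x W ≡ 2

Interlaced : List ℕ → ℕ → ℕ → Set
Interlaced W a b = ((a ∷ b ∷ a ∷ b ∷ []) ⊆ W) ⊎ ((b ∷ a ∷ b ∷ a ∷ []) ⊆ W)

IsoToInterlacement : ∀ {n} → SimpleGraph n → List ℕ → (Fin n → ℕ) → Set
IsoToInterlacement {n} G W f =
  Injective _≡_ _≡_ f
  × (∀ v → f v ∈ W)
  × (∀ x → x ∈ W → ∃[ v ] f v ≡ x)
  × (∀ u v → (adj G u v ≡ true → Interlaced W (f u) (f v))
             × (Interlaced W (f u) (f v) → adj G u v ≡ true))

CircleGraph : ∀ {n} → SimpleGraph n → Set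
CircleGraph {n} G =
  Σ (List ℕ) λ W → DoubleOccurrence W × Σ (Fin n → ℕ) λ f → IsoToInterlacement G W f

Twins : ∀ {n} → SimpleGraph n → Fin n → Fin n → Set
Twins G v₁ v₂ = v₁ ≢ v₂ × (∀ u → u ≢ v₁ → u ≢ v₂ → adj G v₁ u ≡ adj G v₂ u)

TwoDisjointTwinPairs : ∀ {n} → SimpleGraph n → Set
TwoDisjointTwinPairs G =
  ∃[ a ] ∃[ b ] ∃[ c ] ∃[ d ]
    Twins G a b × Twins G c d × a ≢ c × a ≢ d × b ≢ c × b ≢ d

{-# OPTIONS --safe #-}

-- Interlacement is invariant under rotating and reversing the word, so consider arcs (factors) A
-- of a cyclic word.  If no chord inside A contains another one, every chord inside A spans exactly
-- three letters; two such chords starting at consecutive positions, u w a b u w, are twins, and so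
-- are v and u in v u x y z u v.  When at most three letters occur just once in A, avoiding both
-- patterns leaves only u x y z u, u₁ x u₂ y u₁ z u₂, and arcs containing the latter between two
-- copies of a letter v.  In that last case the neighbours of y are u₁, u₂ and v, so y cuts
-- the rest of the circle into two arcs crossed by a single chord each (z, resp. x), and such arcs
-- contain twins by induction.  A first twin pair exists in the whole word; the complement
-- of its arc has at most three singly occurring letters, and yields the second one.
module Submission where

open import Data.Bool using (true)
open import Data.Bool.Properties using (T-≡; ⇔→≡)
open import Data.Empty using (⊥; ⊥-elim)
open import Data.Fin using (Fin; zero)
open import Data.List using (List; []; _∷_; _++_; [_]; length; map; reverse; filter; allFin)
open import Data.List.Membership.Propositional using (_∈_; _∉_)
open import Data.List.Membership.Propositional.Properties using (∈-∃++; ∈-++⁺ˡ; ∈-++⁺ʳ; ∈-++⁻; ∈-filter⁺; ∈-filter⁻; ∈-allFin; ∈-map⁺; ∈-map⁻)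
open import Data.List.Properties using (++-assoc; ++-identityʳ; filter-accept; filter-reject; filter-++; length-++; length-++-≤ˡ; length-++-≤ʳ; length-++-sucʳ; length-map; reverse-++; reverse-involutive; unfold-reverse)
open import Data.List.Relation.Binary.Sublist.Propositional using (_⊆_; []; _∷_; _∷ʳ_; lookup; from∈)
open import Data.List.Relation.Binary.Sublist.Propositional.Properties using (reverse⁺) renaming (++⁺ to ⊆-++⁺)
open import Data.List.Relation.Unary.All using (All; []; _∷_)
import Data.List.Relation.Unary.All as All
open import Data.List.Relation.Unary.AllPairs using ([]; _∷_)
open import Data.List.Relation.Unary.Any using (here; there)
open import Data.List.Relation.Unary.Unique.Propositional using (Unique)
open import Data.List.Relation.Unary.Unique.Propositional.Properties using (map⁺; filter⁺; allFin⁺)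
open import Data.Maybe using (Maybe; just; nothing)
open import Data.Nat using (ℕ; zero; suc; _+_; _<_; _≤_; _≟_; z≤n; s≤s; s≤s⁻¹)
open import Data.Nat.Properties using (+-comm; +-suc; +-monoʳ-≤; ≤-trans; ≤-refl; ≤-reflexive; ≤-antisym; ≤∧≢⇒<; m≤m+n; m≤n+m; suc-injective; <⇒≱)
open import Data.List.Membership.DecPropositional _≟_ using (_∈?_)
open import Data.Product using (_×_; _,_; ∃₂; ∃-syntax; proj₁; proj₂)
open import Data.Sum using (_⊎_; inj₁; inj₂; swap)
open import Data.Unit using (⊤; tt)
open import Function using (_∘_; id; Equivalence; mk⇔)
open import Relation.Binary.PropositionalEquality using (_≡_; _≢_; refl; cong; trans; subst; subst₂; ≢-sym) renaming (sym to ≡-sym)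
open import Relation.Nullary using (¬_; yes; no; contradiction)
open import Relation.Nullary.Decidable using (T?)

open import Defs

-- Lists of letters and the pigeonhole principle.

Word : Set
Word = List ℕ

-- Deletes a single copy of `x`. It drives the pigeonhole principle and later charges each lone
-- letter of an arc to a finite budget.
remove : ∀ {x} {ys : Word} → x ∈ ys →
         ∃[ zs ] length ys ≡ suc (length zs) × (∀ {t} → t ∈ ys → t ≢ x → t ∈ zs)
remove {ys = _ ∷ ys} (here refl) = ys , refl , λ where
  (here refl) t≢x → contradiction refl t≢x
  (there t∈)  _   → t∈
remove {ys = y ∷ _} (there x∈) with zs , eq , keep ← remove x∈ =
  y ∷ zs , cong suc eq , λ where
    (here refl) _   → here refl
    (there t∈)  t≢x → there (keep t∈ t≢x)

pigeonhole : ∀ {xs ys : Word} → Unique xs → (∀ {t} → t ∈ xs → t ∈ ys) → length xs ≤ length ys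
pigeonhole {[]}     _        _  = z≤n
pigeonhole {x ∷ xs} {ys} (x≢ ∷ u) xs⊆ys with zs , eq , keep ← remove (xs⊆ys (here refl)) =
  subst (suc (length xs) ≤_) (≡-sym eq)
    (s≤s (pigeonhole u λ t∈ → keep (xs⊆ys (there t∈)) (≢-sym (All.lookup x≢ t∈))))

missing : ∀ {xs ys : Word} → Unique xs → length ys < length xs → ∃[ t ] t ∈ xs × t ∉ ys
missing {xs} {ys} u ys<xs with All.all? (_∈? ys) xs
... | yes xs⊆ys = contradiction (pigeonhole u (All.lookup xs⊆ys)) (<⇒≱ ys<xs)
... | no  xs⊈ys = search xs xs⊈ys
  where
  search : ∀ zs → ¬ All (_∈ ys) zs → ∃[ t ] t ∈ zs × t ∉ ys
  search []       ¬all = contradiction [] ¬all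
  search (z ∷ zs) ¬all with z ∈? ys
  ... | no z∉ = z , here refl , z∉
  ... | yes z∈ with t , t∈ , t∉ ← search zs (λ all → ¬all (z∈ ∷ all)) = t , there t∈ , t∉

-- Counting occurrences of a letter.

occ-here : ∀ x W → occ x (x ∷ W) ≡ suc (occ x W)
occ-here x W = cong length (filter-accept (_≟ x) refl)

occ-there : ∀ {x y} W → y ≢ x → occ x (y ∷ W) ≡ occ x W
occ-there {x} W y≢x = cong length (filter-reject (_≟ x) y≢x)

occ-++ : ∀ x A B → occ x (A ++ B) ≡ occ x A + occ x B
occ-++ x A B = trans (cong length (filter-++ (_≟ x) A B)) (length-++ (filter (_≟ x) A))

occ-≤ʳ : ∀ x A B → occ x B ≤ occ x (A ++ B)
occ-≤ʳ x A B = subst (occ x B ≤_) (≡-sym (occ-++ x A B)) (m≤n+m _ _)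

occ-≤ˡ : ∀ x A B → occ x A ≤ occ x (A ++ B)
occ-≤ˡ x A B = subst (occ x A ≤_) (≡-sym (occ-++ x A B)) (m≤m+n _ _)

occ-comm : ∀ x A B → occ x (A ++ B) ≡ occ x (B ++ A)
occ-comm x A B = trans (occ-++ x A B) (trans (+-comm (occ x A) _) (≡-sym (occ-++ x B A)))

occ-reverse : ∀ x A → occ x (reverse A) ≡ occ x A
occ-reverse x []      = refl
occ-reverse x (a ∷ A) =
  trans (cong (occ x) (reverse-++ [ a ] A))
  (trans (occ-comm x (reverse A) [ a ])
  (trans (occ-++ x [ a ] (reverse A))
  (trans (cong (occ x [ a ] +_) (occ-reverse x A)) (≡-sym (occ-++ x [ a ] A)))))

∈⇒occ : ∀ {x W} → x ∈ W → 1 ≤ occ x W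
∈⇒occ {x} {_ ∷ W} (here refl) = subst (1 ≤_) (≡-sym (occ-here x W)) (s≤s z≤n)
∈⇒occ {x} {y ∷ W} (there x∈) =
  ≤-trans (∈⇒occ x∈) (occ-≤ʳ x [ y ] W)

occ⇒∈ : ∀ {x} W → 1 ≤ occ x W → x ∈ W
occ⇒∈ {x} (y ∷ W) 1≤ with y ≟ x
... | yes refl = here refl
... | no  y≢x  = there (occ⇒∈ W (subst (1 ≤_) (occ-there W y≢x) 1≤))

∉⇒occ : ∀ {x} W → x ∉ W → occ x W ≡ 0
∉⇒occ {x} W x∉ with occ x W in eq
... | zero  = refl
... | suc _ = contradiction (occ⇒∈ W (subst (1 ≤_) (≡-sym eq) (s≤s z≤n))) x∉

occ-skip : ∀ {x} A B → x ∉ A → occ x (A ++ B) ≡ occ x B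
occ-skip {x} A B x∉ = trans (occ-++ x A B) (cong (_+ occ x B) (∉⇒occ A x∉))

once⇒∈ : ∀ {x} W → occ x W ≡ 1 → x ∈ W
once⇒∈ W eq = occ⇒∈ W (≤-reflexive (≡-sym eq))

unique⇒once : ∀ {x W} → Unique W → x ∈ W → occ x W ≡ 1
unique⇒once {x} {_ ∷ W} (x≢ ∷ _) (here refl) =
  trans (occ-here x W) (cong suc (∉⇒occ W λ x∈ → All.lookup x≢ x∈ refl))
unique⇒once {x} {_ ∷ W} (y≢ ∷ u) (there x∈) = trans (occ-there W (All.lookup y≢ x∈)) (unique⇒once u x∈)

unique-∷ : ∀ {s} {A : Word} → s ∉ A → Unique A → Unique (s ∷ A)
unique-∷ {s} {A} s∉ u = All.tabulate (λ t∈ s≡t → s∉ (subst (_∈ A) (≡-sym s≡t) t∈)) ∷ u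

twice : ∀ x A → x ∈ A → 2 ≤ occ x (x ∷ A)
twice x A x∈ = subst (2 ≤_) (≡-sym (occ-here x A)) (s≤s (∈⇒occ x∈))

-- A letter counted twice is a chord with both ends in `A`, so this decides whether an arc contains
-- a whole chord.
duplicate? : ∀ A → Unique A ⊎ ∃[ w ] 2 ≤ occ w A
duplicate? [] = inj₁ []
duplicate? (x ∷ A) with x ∈? A | duplicate? A
... | yes x∈ | _             = inj₂ (x , twice x A x∈)
... | no _   | inj₂ (w , 2≤) = inj₂ (w , ≤-trans 2≤ (occ-≤ʳ w [ x ] A))
... | no x∉  | inj₁ u        = inj₁ (unique-∷ x∉ u)

⊆⇒occ : ∀ {x A B} → A ⊆ B → occ x A ≤ occ x B
⊆⇒occ []                     = z≤n
⊆⇒occ {x} {A} (y ∷ʳ p)       = ≤-trans (⊆⇒occ p) (occ-≤ʳ x [ y ] _)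
⊆⇒occ {x} {a ∷ A} {a ∷ B} (refl ∷ p) =
  subst₂ _≤_ (≡-sym (occ-++ x [ a ] A)) (≡-sym (occ-++ x [ a ] B)) (+-monoʳ-≤ (occ x [ a ]) (⊆⇒occ p))

-- Interlacement under rotation and reversal.

split⊆ : ∀ {xs} (A : Word) {B} → xs ⊆ A ++ B → ∃₂ λ s t → xs ≡ s ++ t × s ⊆ A × t ⊆ B
split⊆ []      p = [] , _ , refl , [] , p
split⊆ (a ∷ A) (_ ∷ʳ p) with s , t , eq , q , r ← split⊆ A p = s , t , eq , a ∷ʳ q , r
split⊆ (a ∷ A) (refl ∷ p) with s , t , eq , q , r ← split⊆ A p = a ∷ s , t , cong (a ∷_) eq , refl ∷ q , r

-- The cut splits the pattern `abab` in two, and the pieces change places: a first piece of even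
-- length gives `abab` again, one of odd length gives `baba`.
alternating-rotate : ∀ {a b} A {B} → (a ∷ b ∷ a ∷ b ∷ []) ⊆ A ++ B → Interlaced (B ++ A) a b
alternating-rotate A p with split⊆ A p
... | []                    , _ , refl , q , r = inj₁ (⊆-++⁺ r q)
... | _ ∷ []                , _ , refl , q , r = inj₂ (⊆-++⁺ r q)
... | _ ∷ _ ∷ []            , _ , refl , q , r = inj₁ (⊆-++⁺ r q)
... | _ ∷ _ ∷ _ ∷ []        , _ , refl , q , r = inj₂ (⊆-++⁺ r q)
... | _ ∷ _ ∷ _ ∷ _ ∷ []    , _ , refl , q , r = inj₁ (⊆-++⁺ r q)

interlaced-rotate : ∀ {a b} A {B} → Interlaced (A ++ B) a b → Interlaced (B ++ A) a b
interlaced-rotate A (inj₁ p) = alternating-rotate A p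
interlaced-rotate A (inj₂ p) = swap (alternating-rotate A p)

interlaced-reverse : ∀ {a b} {W} → Interlaced W a b → Interlaced (reverse W) a b
interlaced-reverse (inj₁ p) = inj₂ (reverse⁺ p)
interlaced-reverse (inj₂ p) = inj₁ (reverse⁺ p)

-- Chords of a cyclic word and the criteria for crossing.

module Chords (W₀ : Word) (W₀-double : DoubleOccurrence W₀) where

  _⨯_ : ℕ → ℕ → Set
  a ⨯ b = Interlaced W₀ a b

  ⨯-sym : ∀ {a b} → a ⨯ b → b ⨯ a
  ⨯-sym = swap

  ⨯-letter : ∀ {a b} → a ⨯ b → b ∈ W₀
  ⨯-letter (inj₁ p) = lookup p (there (here refl))
  ⨯-letter (inj₂ p) = lookup p (here refl)

  -- W and W₀ are double occurrence words for the same interlacement graph on the same letters.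
  record Rep (W : Word) : Set where
    field
      double : DoubleOccurrence W
      from⨯  : ∀ {a b} → a ⨯ b → Interlaced W a b
      to⨯    : ∀ {a b} → Interlaced W a b → a ⨯ b
      letter : ∀ {x} → x ∈ W → x ∈ W₀
      letter⁻ : ∀ {x} → x ∈ W₀ → x ∈ W
  open Rep public

  self : Rep W₀
  self = record { double = W₀-double ; from⨯ = id ; to⨯ = id ; letter = id ; letter⁻ = id }

  -- Proofs are opaque so that with-abstraction does not normalise them.
  opaque
    rotate : ∀ A {B} → Rep (A ++ B) → Rep (B ++ A)
    rotate A {B} r = record
      { double = λ x x∈ → trans (occ-comm x B A) (double r x (mem B x∈))
      ; from⨯  = interlaced-rotate A ∘ from⨯ r
      ; to⨯    = to⨯ r ∘ interlaced-rotate B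
      ; letter = letter r ∘ mem B
      ; letter⁻ = mem A ∘ letter⁻ r
      }
      where
      mem : ∀ {x : ℕ} (C : Word) {D} → x ∈ C ++ D → x ∈ D ++ C
      mem C {D} x∈ with ∈-++⁻ C x∈
      ... | inj₁ x∈C = ∈-++⁺ʳ D x∈C
      ... | inj₂ x∈D = ∈-++⁺ˡ x∈D

  opaque
    flip : ∀ {W} → Rep W → Rep (reverse W)
    flip {W} r = record
      { double = λ x x∈ → trans (occ-reverse x W) (double r x (mem x∈))
      ; from⨯  = interlaced-reverse ∘ from⨯ r
      ; to⨯    = to⨯ r ∘ subst (λ V → Interlaced V _ _) (reverse-involutive W) ∘ interlaced-reverse
      ; letter = letter r ∘ mem
      ; letter⁻ = λ {x} x∈ → occ⇒∈ (reverse W) (subst (1 ≤_) (≡-sym (occ-reverse x W)) (∈⇒occ (letter⁻ r x∈)))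
      }
      where
      mem : ∀ {x} → x ∈ reverse W → x ∈ W
      mem {x} x∈ = occ⇒∈ W (subst (1 ≤_) (occ-reverse x W) (∈⇒occ x∈))

  opaque
    occ-sum : ∀ {x} A {γ} → Rep (A ++ γ) → x ∈ W₀ → occ x A + occ x γ ≡ 2
    occ-sum {x} A {γ} r x∈ = trans (≡-sym (occ-++ x A γ)) (double r x (letter⁻ r x∈))

  occ≤2 : ∀ {W} → Rep W → ∀ x → occ x W ≤ 2
  occ≤2 {W} r x with x ∈? W
  ... | yes x∈ = ≤-reflexive (double r x x∈)
  ... | no  x∉ = subst (_≤ 2) (≡-sym (∉⇒occ W x∉)) z≤n

  opaque
    -- Both counts are positive and they add up to two.
    split-once : ∀ {x} A {γ} → Rep (A ++ γ) → x ∈ A → x ∈ γ → occ x A ≡ 1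
    split-once {x} A {γ} r x∈A x∈γ
      with occ x A | occ x γ | ∈⇒occ x∈A | ∈⇒occ x∈γ | occ-sum A r (letter r (∈-++⁺ˡ x∈A))
    ... | suc zero    | _           | _ | _ | _  = refl
    ... | suc (suc _) | suc _       | _ | _ | eq = contradiction (trans (≡-sym (+-suc _ _)) (suc-injective (suc-injective eq))) λ ()

  opaque
    once-split : ∀ {x} A {γ} → Rep (A ++ γ) → occ x A ≡ 1 → x ∈ γ
    once-split {x} A {γ} r eq = once⇒∈ γ
      (suc-injective (trans (cong (_+ occ x γ) (≡-sym eq)) (occ-sum A r (letter r (∈-++⁺ˡ (once⇒∈ A eq))))))

  opaque
    full⇒outside : ∀ {x} A {γ} → Rep (A ++ γ) → 2 ≤ occ x A → x ∉ γ
    full⇒outside {x} A r 2≤ x∈γ with split-once A r (occ⇒∈ A (≤-trans (s≤s z≤n) 2≤)) x∈γ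
    ... | eq = contradiction (subst (2 ≤_) eq 2≤) λ { (s≤s ()) }

  opaque
    -- Cutting before the second displayed `v` leaves a copy on either side, hence exactly one in
    -- `v ∷ B`, and that is the head.
    end∉ : ∀ {v} B {γ} → Rep (v ∷ B ++ v ∷ γ) → v ∉ B
    end∉ {v} B r v∈B = contradiction
      (trans (≡-sym (occ-here v B)) (split-once (v ∷ B) r (here refl) (here refl)))
      (λ eq → contradiction (subst (1 ≤_) (suc-injective eq) (∈⇒occ v∈B)) λ ())

  opaque
    end∉ʳ : ∀ {v} B {γ} → Rep (v ∷ B ++ v ∷ γ) → v ∉ γ
    end∉ʳ {v} B {γ} r = end∉ γ (rotate (v ∷ B) r)

  opaque
    -- The two displayed copies of `v` are the only ones. An embedded alternating pattern must use
    -- them for its letters `v`; every other placement would put a `v` into `B` or `γ`.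
    crosses⇒ends : ∀ {v t} B {γ} → Rep (v ∷ B ++ v ∷ γ) → v ⨯ t → t ∈ B × t ∈ γ
    crosses⇒ends {v} {t} B {γ} r v⨯t with from⨯ r v⨯t
    ... | inj₁ p = go (tail p)
      where
      v∉B : v ∉ B
      v∉B = end∉ B r
      v∉γ : v ∉ γ
      v∉γ = end∉ʳ B r
      tail : (v ∷ t ∷ v ∷ t ∷ []) ⊆ v ∷ B ++ v ∷ γ → (t ∷ v ∷ t ∷ []) ⊆ B ++ v ∷ γ
      tail (_ ∷ p)  = p
      tail (_ ∷ʳ p) = ⊆-tail p
        where
        ⊆-tail : ∀ {x} {xs ys : Word} → x ∷ xs ⊆ ys → xs ⊆ ys
        ⊆-tail (_ ∷ p)  = _ ∷ʳ p
        ⊆-tail (_ ∷ʳ p) = _ ∷ʳ ⊆-tail p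
      go : (t ∷ v ∷ t ∷ []) ⊆ B ++ v ∷ γ → t ∈ B × t ∈ γ
      go p with split⊆ B p
      ... | []               , _ , refl , q , _ ∷ s   = contradiction (lookup s (here refl)) v∉γ
      ... | []               , _ , refl , q , _ ∷ʳ s  = contradiction (lookup s (there (here refl))) v∉γ
      ... | _ ∷ []           , _ , refl , q , _ ∷ s   = lookup q (here refl) , lookup s (here refl)
      ... | _ ∷ []           , _ , refl , q , _ ∷ʳ s  = contradiction (lookup s (here refl)) v∉γ
      ... | _ ∷ _ ∷ []       , _ , refl , q , _       = contradiction (lookup q (there (here refl))) v∉B
      ... | _ ∷ _ ∷ _ ∷ []   , _ , refl , q , _       = contradiction (lookup q (there (here refl))) v∉B
    -- In `tvtv` both copies of `v` come after a `t`, but the word begins with one of its two copies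
    -- of `v`.
    ... | inj₂ p = ⊥-elim (go p)
      where
      v∉B : v ∉ B
      v∉B = end∉ B r
      v∉γ : v ∉ γ
      v∉γ = end∉ʳ B r
      rest : ∀ {xs : Word} → (t ∷ v ∷ xs) ⊆ v ∷ γ → ⊥
      rest (_ ∷ q)  = v∉γ (lookup q (here refl))
      rest (_ ∷ʳ q) = v∉γ (lookup q (there (here refl)))
      rest′ : (v ∷ t ∷ v ∷ []) ⊆ v ∷ γ → ⊥
      rest′ (_ ∷ q)  = v∉γ (lookup q (there (here refl)))
      rest′ (_ ∷ʳ q) = v∉γ (lookup q (here refl))
      inner : (t ∷ v ∷ t ∷ v ∷ []) ⊆ B ++ v ∷ γ → ⊥
      inner p with split⊆ B p
      ... | []          , _ , refl , _ , s = rest s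
      ... | _ ∷ []      , _ , refl , _ , s = rest′ s
      ... | _ ∷ _ ∷ []  , _ , refl , q , _ = v∉B (lookup q (there (here refl)))
      ... | _ ∷ _ ∷ _ ∷ []     , _ , refl , q , _ = v∉B (lookup q (there (here refl)))
      ... | _ ∷ _ ∷ _ ∷ _ ∷ [] , _ , refl , q , _ = v∉B (lookup q (there (here refl)))
      go : (t ∷ v ∷ t ∷ v ∷ []) ⊆ v ∷ B ++ v ∷ γ → ⊥
      go (_ ∷ʳ p) = inner p
      go (refl ∷ p) with split⊆ B p
      ... | []    , _ , refl , _ , s = rest′ s
      ... | _ ∷ []         , _ , refl , q , _ = v∉B (lookup q (here refl))
      ... | _ ∷ _ ∷ []     , _ , refl , q , _ = v∉B (lookup q (here refl))
      ... | _ ∷ _ ∷ _ ∷ [] , _ , refl , q , _ = v∉B (lookup q (here refl))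

  opaque
    crosses⇒once : ∀ {v t} B {γ} → Rep (v ∷ B ++ v ∷ γ) → v ⨯ t → occ t B ≡ 1
    crosses⇒once {v} {t} B r v⨯t with crosses⇒ends B r v⨯t
    ... | t∈B , t∈γ = trans (≡-sym (occ-there {y = v} B λ { refl → end∉ B r t∈B }))
                            (split-once (v ∷ B) r (there t∈B) (there t∈γ))

  opaque
    ends⇒crosses : ∀ {v t} B {γ} → Rep (v ∷ B ++ v ∷ γ) → t ∈ B → t ∈ γ → v ⨯ t
    ends⇒crosses B r t∈B t∈γ = to⨯ r (inj₁ (refl ∷ ⊆-++⁺ (from∈ t∈B) (refl ∷ from∈ t∈γ)))

  opaque
    -- The second copy of `t` lies beyond `B`, and it is not the closing `v` because `v` does not
    -- occur in `B`.
    once⇒crosses : ∀ {v t} B {γ} → Rep (v ∷ B ++ v ∷ γ) → occ t B ≡ 1 → v ⨯ t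
    once⇒crosses {v} {t} B {γ} r eq = ends⇒crosses B r t∈B t∈γ
      where
      t∈B : t ∈ B
      t∈B = once⇒∈ B eq
      v≢t : v ≢ t
      v≢t refl = end∉ B r t∈B
      t∈γ : t ∈ γ
      t∈γ with once-split (v ∷ B) r (trans (occ-there B v≢t) eq)
      ... | here t≡v = contradiction (≡-sym t≡v) v≢t
      ... | there t∈ = t∈

-- Arcs in which every chord spans three letters.

-- A suffix of an arc in which every chord spans exactly three letters: pᵢ = just u means that
-- the i-th letter still to come closes the chord u, and k bounds the number of lone letters.
data Run : ℕ → (p₁ p₂ p₃ p₄ : Maybe ℕ) → Word → Set where
  done  : ∀ {k} → Run k nothing nothing nothing nothing []
  close : ∀ {k u p₂ p₃ p₄ A} → Run k p₂ p₃ p₄ nothing A → Run k (just u) p₂ p₃ p₄ (u ∷ A)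
  start : ∀ {k u p₂ p₃ p₄ A} → Run k p₂ p₃ p₄ (just u) A → Run k nothing p₂ p₃ p₄ (u ∷ A)
  lone  : ∀ {k s p₂ p₃ p₄ A} → s ∉ A → Run k p₂ p₃ p₄ nothing A → Run (suc k) nothing p₂ p₃ p₄ (s ∷ A)

data Twinned : Word → Set where
  adjacent : ∀ {u w a b} → Twinned (u ∷ w ∷ a ∷ b ∷ u ∷ w ∷ [])
  nested   : ∀ {v u x y z} → Twinned (v ∷ u ∷ x ∷ y ∷ z ∷ u ∷ v ∷ [])

-- The shape `linked` enclosed by the two copies of `v`. Its hub `y` turns out to be adjacent
-- exactly to the spokes `u₁`, `u₂` and `v`.
data Wheel : Word → Set where
  wheel : ∀ {v u₁ x u₂ y z} → Wheel (v ∷ u₁ ∷ x ∷ u₂ ∷ y ∷ u₁ ∷ z ∷ u₂ ∷ v ∷ [])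

-- For `x ≡ z` the second shape would begin with `u₁ x u₂ y u₁ x`, which already shows the twins
-- `u₁` and `x`.
data Exceptional : Word → Set where
  triple : ∀ {u x y z} → Exceptional (u ∷ x ∷ y ∷ z ∷ u ∷ [])
  linked : ∀ {u₁ x u₂ y z} → x ≢ z → Exceptional (u₁ ∷ x ∷ u₂ ∷ y ∷ u₁ ∷ z ∷ u₂ ∷ [])

data Has (P : Word → Set) : Word → Set where
  at : ∀ α {T} β → P T → Has P (α ++ T ++ β)

has-∷ : ∀ {P A} x → Has P A → Has P (x ∷ A)
has-∷ x (at α β p) = at (x ∷ α) β p

has-++ˡ : ∀ {P A} α → Has P A → Has P (α ++ A)
has-++ˡ []      h = h
has-++ˡ (x ∷ α) h = has-∷ x (has-++ˡ α h)

has-++ʳ : ∀ {P A} β → Has P A → Has P (A ++ β)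
has-++ʳ {P} β (at α {T} β′ p) =
  subst (Has P) (≡-sym (trans (++-assoc α (T ++ β′) β) (cong (α ++_) (++-assoc T β′ β)))) (at α (β′ ++ β) p)

-- Chords that open at consecutive positions also close at consecutive positions. The nine clauses
-- run through what the two letters in between may be.
two-starts : ∀ {k p₁ p₂ u w A} → Run k p₁ p₂ (just u) (just w) A → Has Twinned (u ∷ w ∷ A)
two-starts (close (close (close (close _))))   = at [] _ adjacent
two-starts (close (start (close (close _))))   = at [] _ adjacent
two-starts (close (lone _ (close (close _))))  = at [] _ adjacent
two-starts (start (close (close (close _))))   = at [] _ adjacent
two-starts (start (start (close (close _))))   = at [] _ adjacent
two-starts (start (lone _ (close (close _))))  = at [] _ adjacent
two-starts (lone _ (close (close (close _))))  = at [] _ adjacent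
two-starts (lone _ (start (close (close _))))  = at [] _ adjacent
two-starts (lone _ (lone _ (close (close _)))) = at [] _ adjacent

-- run k-i: at most k lone letters remain and a chord is about to close at position i.
run₀-4 : ∀ {u A} → Run 0 nothing nothing nothing (just u) A → Has Twinned (u ∷ A)
run₀-4 (start r) = two-starts r

run₀-3 : ∀ {u A} → Run 0 nothing nothing (just u) nothing A → Has Twinned A
run₀-3 (start (start r)) = two-starts r

run₀-2 : ∀ {u A} → Run 0 nothing (just u) nothing nothing A → Has Twinned A
run₀-2 (start (close r)) = has-∷ _ (has-∷ _ (run₀-3 r))

run₁-3 : ∀ {u A} → Run 1 nothing nothing (just u) nothing A → Has Twinned A
run₁-3 (start (start r))            = two-starts r
run₁-3 (start (lone _ (close r)))   = has-∷ _ (has-∷ _ (has-∷ _ (run₀-2 r)))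
run₁-3 (lone _ r)                   = has-∷ _ (run₀-2 r)

run₁-4 : ∀ {u A} → Run 1 nothing nothing nothing (just u) A → Has Twinned (u ∷ A)
run₁-4 (start r)             = two-starts r
run₁-4 (lone _ (start r))    = has-∷ _ (has-∷ _ (run₀-34 r))
  where
  run₀-34 : ∀ {u w A} → Run 0 nothing (just u) nothing (just w) A → Has Twinned (w ∷ A)
  run₀-34 (start r) = two-starts r

run₂-4 : ∀ {u A} → Run 2 nothing nothing nothing (just u) A → Has Twinned (u ∷ A)
run₂-4 (start r)  = two-starts r
run₂-4 (lone _ r) = has-∷ _ (has-∷ _ (run₁-3 r))

-- Consecutive starts give twins, so at least two of the three letters under `u` are lone. If all
-- three are, no lone letter remains and the arc must end at once. If one remains, only the shape
-- `linked` escapes.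
run₃-4 : ∀ {u A} → Run 3 nothing nothing nothing (just u) A → Has Twinned (u ∷ A) ⊎ Exceptional (u ∷ A)
run₃-4 (start r)                                               = inj₁ (two-starts r)
run₃-4 (lone _ (start (start r)))                              = inj₁ (has-∷ _ (has-∷ _ (two-starts r)))
run₃-4 (lone _ (start (lone _ (close (start (close r))))))     = inj₁ (has-∷ _ (has-∷ _ (has-∷ _ (has-∷ _ (has-∷ _ (has-∷ _ (has-∷ _ (run₁-3 r))))))))
-- A lone letter does not recur in the rest of the arc, which contains `z`; hence `x ≢ z`.
run₃-4 (lone x∉ (start (lone _ (close (lone _ (close done)))))) =
  inj₂ (linked λ { refl → x∉ (there (there (there (here refl)))) })
run₃-4 (lone _ (start (lone _ (close (lone _ (close (start r))))))) =
  inj₁ (has-∷ _ (has-∷ _ (has-∷ _ (has-∷ _ (has-∷ _ (has-∷ _ (has-∷ _ (run₀-4 r))))))))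
run₃-4 (lone _ (lone _ (start (close r))))                     = inj₁ (has-∷ _ (has-∷ _ (has-∷ _ (has-∷ _ (has-∷ _ (run₁-3 r))))))
run₃-4 (lone _ (lone _ (lone _ (close done))))                 = inj₂ triple
run₃-4 (lone _ (lone _ (lone _ (close (start r)))))            =
  inj₁ (has-∷ _ (has-∷ _ (has-∷ _ (has-∷ _ (has-∷ _ (run₀-4 r))))))

unique-ends : ∀ {A} → Run 0 nothing nothing nothing nothing A → Has Twinned A ⊎ Unique A
unique-ends done      = inj₂ []
unique-ends (start r) = inj₁ (run₀-4 r)

opaque
  -- Lone letters before the first chord use up the budget, and with fewer than three left a chord
  -- always leads to twins. So an exceptional arc opens with a chord.
  classify : ∀ {A} → Run 3 nothing nothing nothing nothing A → Has Twinned A ⊎ Exceptional A ⊎ Unique A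
  classify done = inj₂ (inj₂ [])
  classify (start r) with run₃-4 r
  ... | inj₁ h = inj₁ h
  ... | inj₂ e = inj₂ (inj₁ e)
  classify (lone s∉ done) = inj₂ (inj₂ (unique-∷ s∉ []))
  classify (lone s∉ (start r)) = inj₁ (has-∷ _ (run₂-4 r))
  classify (lone s∉ (lone t∉ done)) = inj₂ (inj₂ (unique-∷ s∉ (unique-∷ t∉ [])))
  classify (lone s∉ (lone t∉ (start r))) = inj₁ (has-∷ _ (has-∷ _ (run₁-4 r)))
  classify (lone s∉ (lone t∉ (lone x∉ r))) with unique-ends r
  ... | inj₁ h = inj₁ (has-∷ _ (has-∷ _ (has-∷ _ h)))
  ... | inj₂ u = inj₂ (inj₂ (unique-∷ s∉ (unique-∷ t∉ (unique-∷ x∉ u))))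

-- Announced closings of chords.

-- The letters announced by a window are those found at its positions, for the last time.
Due : List (Maybe ℕ) → Word → Set
Due []             _       = ⊤
Due (nothing ∷ ps) []      = Due ps []
Due (nothing ∷ ps) (_ ∷ A) = Due ps A
Due (just _ ∷ _)   []      = ⊥
Due (just u ∷ ps)  (a ∷ A) = (a ≡ u × u ∉ A) × Due ps A

due-∈ : ∀ {u} ps A → Due ps A → just u ∈ ps → u ∈ A
due-∈ (nothing ∷ ps) []      d (there m)                 = due-∈ ps [] d m
due-∈ (nothing ∷ ps) (_ ∷ A) d (there m)                 = there (due-∈ ps A d m)
due-∈ (just _ ∷ ps)  (_ ∷ A) ((refl , _) , d) (here refl) = here refl
due-∈ (just _ ∷ ps)  (_ ∷ A) (_ , d) (there m)           = there (due-∈ ps A d m)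

due-nothing : ∀ ps A → Due ps A → Due (ps ++ [ nothing ]) A
due-nothing []             []      _       = tt
due-nothing []             (_ ∷ _) _       = tt
due-nothing (nothing ∷ ps) []      d       = due-nothing ps [] d
due-nothing (nothing ∷ ps) (_ ∷ A) d       = due-nothing ps A d
due-nothing (just _ ∷ ps)  (_ ∷ A) (e , d) = e , due-nothing ps A d

-- As `B` is as long as `ps`, the slot appended to the window faces the displayed `u`.
due-just : ∀ {u β} ps B → length ps ≡ length B → u ∉ β → Due ps (B ++ u ∷ β) → Due (ps ++ [ just u ]) (B ++ u ∷ β)
due-just []             []      _   u∉ _       = (refl , u∉) , tt
due-just (nothing ∷ ps) (_ ∷ B) len u∉ d       = due-just ps B (suc-injective len) u∉ d
due-just (just _ ∷ ps)  (_ ∷ B) len u∉ (e , d) = e , due-just ps B (suc-injective len) u∉ d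

-- Consequences of three-regularity for chords.

module Cubic (W₀ : Word) (W₀-double : DoubleOccurrence W₀)
  (neighbours : ∀ {v} → v ∈ W₀ → ∃[ L ] length L ≡ 3 × Unique L ×
     (∀ {t} → Interlaced W₀ v t → t ∈ L) × (∀ {t} → t ∈ L → Interlaced W₀ v t)) where

  open Chords W₀ W₀-double public

  opaque
    another : ∀ {v} ys → v ∈ W₀ → length ys < 3 → ∃[ t ] v ⨯ t × t ∉ ys
    another ys v∈ ys<3 with L , len , u , _ , L⨯ ← neighbours v∈
      with t , t∈ , t∉ ← missing {ys = ys} u (subst (length ys <_) (≡-sym len) ys<3) = t , L⨯ t∈ , t∉

  opaque
    crowded : ∀ {v xs} → v ∈ W₀ → Unique xs → All (v ⨯_) xs → 3 < length xs → ⊥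
    crowded v∈ u xs⨯ 3< with L , len , _ , ⨯L , _ ← neighbours v∈ =
      <⇒≱ 3< (subst (_ ≤_) len (pigeonhole u (⨯L ∘ All.lookup xs⨯)))

  opaque
    -- If no letter repeats in `B`, each of its letters crosses `v`; conversely every neighbour of
    -- `v` has an end in `B`. So `B` lists the three neighbours, and the pigeonhole principle
    -- applies both ways.
    chord-length : ∀ {v} B {γ} → Rep (v ∷ B ++ v ∷ γ) → Unique B → length B ≡ 3
    chord-length B r uB with L , len , uL , ⨯L , L⨯ ← neighbours (letter r (here refl)) =
      trans (≤-antisym (pigeonhole uB (⨯L ∘ once⇒crosses B r ∘ unique⇒once uB))
                       (pigeonhole uL (once⇒∈ B ∘ crosses⇒once B r ∘ L⨯))) len

  opaque
    -- All three neighbours of `v` are among `p`, `q`, `s`; a coincidence would leave room for only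
    -- two.
    chord-unique : ∀ {v p q s γ} → Rep (v ∷ p ∷ q ∷ s ∷ v ∷ γ) → Unique (p ∷ q ∷ s ∷ [])
    chord-unique {v} {p} {q} {s} r = (p≢q ∷ p≢s ∷ []) ∷ (q≢s ∷ []) ∷ [] ∷ []
      where
      two : ∀ ys → length ys < 3 → (∀ {t} → t ∈ p ∷ q ∷ s ∷ [] → t ∈ ys) → ⊥
      two ys ys<3 B⊆ with t , v⨯t , t∉ ← another ys (letter r (here refl)) ys<3 =
        t∉ (B⊆ (once⇒∈ (p ∷ q ∷ s ∷ []) (crosses⇒once (p ∷ q ∷ s ∷ []) r v⨯t)))
      p≢q : p ≢ q
      p≢q refl = two (p ∷ s ∷ []) ≤-refl λ { (here e) → here e ; (there (here e)) → here e ; (there (there m)) → there m }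
      p≢s : p ≢ s
      p≢s refl = two (p ∷ q ∷ []) ≤-refl λ { (here e) → here e ; (there (here e)) → there (here e) ; (there (there (here e))) → here e }
      q≢s : q ≢ s
      q≢s refl = two (p ∷ q ∷ []) ≤-refl λ { (here e) → here e ; (there (here e)) → there (here e) ; (there (there (here e))) → there (here e) }

  -- Arcs: scanning and dissection.

  Arc : Word → Set
  Arc A = ∃[ γ ] Rep (A ++ γ)

  opaque
    rep-factor : ∀ α B β {γ} → Rep ((α ++ B ++ β) ++ γ) → Rep (B ++ β ++ γ ++ α)
    rep-factor α B β {γ} r = subst Rep
      (trans (++-assoc (B ++ β) γ α) (++-assoc B β (γ ++ α)))
      (rotate α (subst Rep (++-assoc α (B ++ β) γ) r))

  opaque
    arc-factor : ∀ α B β → Arc (α ++ B ++ β) → Arc B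
    arc-factor α B β (_ , r) = _ , rep-factor α B β r

  opaque
    arc-tail : ∀ {x A} → Arc (x ∷ A) → Arc A
    arc-tail {x} {A} (γ , r) = γ ++ [ x ] , subst Rep (++-assoc A γ [ x ]) (rotate [ x ] r)

  opaque
    arc-inside : ∀ {v} B {γ} → Rep (v ∷ B ++ v ∷ γ) → Arc B
    arc-inside {v} B {γ} r = arc-factor [ v ] B [] (v ∷ γ , subst (λ V → Rep (v ∷ V ++ v ∷ γ)) (≡-sym (++-identityʳ B)) r)

  -- A chord `v` with a whole chord `w` inside it, which is the obstruction to reading the arc as a
  -- `Run`.
  data Nested : Word → Set where
    nest : ∀ α v B β {w} → 2 ≤ occ w B → Nested (α ++ v ∷ B ++ v ∷ β)

  nested-∷ : ∀ {A} x → Nested A → Nested (x ∷ A)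
  nested-∷ x (nest α v B β 2≤) = nest (x ∷ α) v B β 2≤

  opaque
    -- Reads the arc from left to right. A letter closes an announced chord, or starts a chord whose
    -- closing is then announced, or is lone and is struck from `L`. The last condition is the
    -- invariant that makes `L` account for all lone letters to come.
    scan : ∀ {p₁ p₂ p₃ p₄} A L → Arc A → Due (p₁ ∷ p₂ ∷ p₃ ∷ p₄ ∷ []) A →
           (∀ {t} → occ t A ≡ 1 → just t ∈ (p₁ ∷ p₂ ∷ p₃ ∷ p₄ ∷ []) ⊎ t ∈ L) →
           Nested A ⊎ Run (length L) p₁ p₂ p₃ p₄ A
    scan {nothing} {nothing} {nothing} {nothing} [] L _ _ _ = inj₂ done
    scan {nothing} {nothing} {nothing} {just _}  [] L _ () _
    scan {nothing} {nothing} {just _}            [] L _ () _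
    scan {nothing} {just _}                      [] L _ () _
    scan {just _}                                [] L _ () _
    scan {just x} {p₂} {p₃} {p₄} (.x ∷ A) L arc ((refl , x∉A) , due) cover
      with scan A L (arc-tail arc) (due-nothing (p₂ ∷ p₃ ∷ p₄ ∷ []) A due) cover′
      where
      cover′ : ∀ {t} → occ t A ≡ 1 → just t ∈ (p₂ ∷ p₃ ∷ p₄ ∷ nothing ∷ []) ⊎ t ∈ L
      cover′ {t} eq with cover {t} (trans (occ-there {y = x} A λ { refl → x∉A (once⇒∈ A eq) }) eq)
      ... | inj₁ (here refl) = contradiction (once⇒∈ A eq) x∉A
      ... | inj₁ (there m)   = inj₁ (∈-++⁺ˡ m)
      ... | inj₂ t∈L         = inj₂ t∈L
    ... | inj₁ n = inj₁ (nested-∷ _ n)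
    ... | inj₂ r = inj₂ (close r)
    scan {nothing} {p₂} {p₃} {p₄} (x ∷ A) L arc due cover with x ∈? A
    -- A letter that does not recur is not announced either, since announced letters still occur in
    -- `A`; it must be in `L`.
    ... | no x∉A with cover {x} (trans (occ-here x A) (cong suc (∉⇒occ A x∉A)))
    ...   | inj₁ (there m) = contradiction (due-∈ (p₂ ∷ p₃ ∷ p₄ ∷ []) A due m) x∉A
    ...   | inj₂ x∈L with L′ , eq , keep ← remove x∈L
      with scan A L′ (arc-tail arc) (due-nothing (p₂ ∷ p₃ ∷ p₄ ∷ []) A due) cover′
      where
      cover′ : ∀ {t} → occ t A ≡ 1 → just t ∈ (p₂ ∷ p₃ ∷ p₄ ∷ nothing ∷ []) ⊎ t ∈ L′
      cover′ {t} eq with x ≟ t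
      ... | yes refl = contradiction (once⇒∈ A eq) x∉A
      ... | no x≢t with cover {t} (trans (occ-there A x≢t) eq)
      ...   | inj₁ (there m) = inj₁ (∈-++⁺ˡ m)
      ...   | inj₂ t∈L       = inj₂ (keep t∈L (≢-sym x≢t))
    ...     | inj₁ n = inj₁ (nested-∷ _ n)
    ...     | inj₂ r = inj₂ (subst (λ k → Run k nothing p₂ p₃ p₄ (x ∷ A)) (≡-sym eq) (lone x∉A r))
    scan {nothing} {p₂} {p₃} {p₄} (x ∷ A) L arc@(γ , rep) due cover | yes x∈A
      with B , β , A≡ ← ∈-∃++ x∈A
      with rep′ ← subst Rep (trans (cong (λ V → x ∷ V ++ γ) A≡) (cong (x ∷_) (++-assoc B (x ∷ β) γ))) rep
      with duplicate? B
    ... | inj₂ (w , 2≤) = inj₁ (subst (Nested ∘ (x ∷_)) (≡-sym A≡) (nest [] x B β 2≤))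
    -- With no repetition in `B`, exactly three letters precede the closing `x`, so it is announced
    -- in the fourth slot of the shifted window.
    ... | inj₁ uB
      with scan A L (arc-tail arc)
        (subst (Due (p₂ ∷ p₃ ∷ p₄ ∷ just x ∷ [])) (≡-sym A≡)
          (due-just (p₂ ∷ p₃ ∷ p₄ ∷ []) B (≡-sym (chord-length B rep′ uB))
            (end∉ʳ B rep′ ∘ ∈-++⁺ˡ)
            (subst (Due (p₂ ∷ p₃ ∷ p₄ ∷ [])) A≡ due)))
        cover′
      where
      cover′ : ∀ {t} → occ t A ≡ 1 → just t ∈ (p₂ ∷ p₃ ∷ p₄ ∷ just x ∷ []) ⊎ t ∈ L
      cover′ {t} eq with x ≟ t
      ... | yes refl = inj₁ (there (there (there (here refl))))
      ... | no x≢t with cover {t} (trans (occ-there A x≢t) eq)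
      ...   | inj₁ (there m) = inj₁ (∈-++⁺ˡ m)
      ...   | inj₂ t∈L       = inj₂ t∈L
    ...   | inj₁ n = inj₁ (nested-∷ _ n)
    ...   | inj₂ r = inj₂ (start r)

  opaque
    chord₃⇒ : ∀ {v p q s t γ} → Rep (v ∷ p ∷ q ∷ s ∷ v ∷ γ) → v ⨯ t → t ∈ p ∷ q ∷ s ∷ []
    chord₃⇒ {p = p} {q} {s} r v⨯t = proj₁ (crosses⇒ends (p ∷ q ∷ s ∷ []) r v⨯t)

  opaque
    chord₃⇐ : ∀ {v p q s t γ} → Rep (v ∷ p ∷ q ∷ s ∷ v ∷ γ) → t ∈ p ∷ q ∷ s ∷ [] → v ⨯ t
    chord₃⇐ {p = p} {q} {s} r t∈ = once⇒crosses (p ∷ q ∷ s ∷ []) r (unique⇒once (chord-unique r) t∈)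

  opaque
    -- Induction on a bound `n` for the length. Without nested chords the arc is a `Run`, which
    -- `classify` settles. Otherwise the inside of the outer chord is dissected. The assumed chord
    -- `w` excludes arcs of distinct letters.
    dissect : ∀ n A L → length A < n → Arc A → length L ≡ 3 → (∀ {t} → occ t A ≡ 1 → t ∈ L) →
              ∃[ w ] 2 ≤ occ w A → Has Twinned A ⊎ Has Wheel A ⊎ Exceptional A
    dissect (suc n) A L A<n arc len cover (w , 2≤w)
      with scan {nothing} {nothing} {nothing} {nothing} A L arc
             (due-nothing (nothing ∷ nothing ∷ nothing ∷ []) A (due-nothing (nothing ∷ nothing ∷ []) A
               (due-nothing [ nothing ] A (due-nothing [] A tt))))
             (inj₂ ∘ cover)
    ... | inj₂ run with classify (subst (λ k → Run k nothing nothing nothing nothing A) len run)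
    ...   | inj₁ h        = inj₁ h
    ...   | inj₂ (inj₁ e) = inj₂ (inj₂ e)
    ...   | inj₂ (inj₂ u) = contradiction 2≤w
      (subst (λ k → ¬ 2 ≤ k) (≡-sym (unique⇒once u (occ⇒∈ A (≤-trans (s≤s z≤n) 2≤w)))) λ { (s≤s ()) })
    dissect (suc n) _ _ A<n (γ , rep) _ _ _ | inj₁ (nest α v B β {w} 2≤w)
      with r ← rep-factor α (v ∷ B) (v ∷ β) rep
      -- A letter occurring once in `B` crosses `v`, so the three neighbours of `v` serve as the new
      -- budget.
      with L , len , _ , ⨯L , _ ← neighbours (letter r (here refl))
      with dissect n B L (≤-trans inside (s≤s⁻¹ A<n)) (arc-inside B r) len (⨯L ∘ once⇒crosses B r) (w , 2≤w)
      where
      inside : length B < length (α ++ v ∷ B ++ v ∷ β)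
      inside = ≤-trans (s≤s (length-++-≤ˡ B)) (length-++-≤ʳ (v ∷ B ++ v ∷ β) {α})
    ... | inj₁ h                   = inj₁ (has-++ˡ α (has-∷ v (has-++ʳ (v ∷ β) h)))
    ... | inj₂ (inj₁ h)            = inj₂ (inj₁ (has-++ˡ α (has-∷ v (has-++ʳ (v ∷ β) h))))
    -- An exceptional inside, enclosed by `v`, becomes nested twins or a wheel.
    ... | inj₂ (inj₂ triple)       = inj₁ (at α β nested)
    ... | inj₂ (inj₂ (linked _))   = inj₂ (inj₁ (at α β wheel))

  -- Lone letters of exceptional arcs.

  opaque
    -- Since `u₁` crosses `y`, the second end of `y` lies beyond the chord `u₁`; it is neither `z`
    -- nor `u₂`, as both chords span distinct letters and do not contain their own ends.
    linked-middle : ∀ {u₁ x u₂ y z γ} → Rep (u₁ ∷ x ∷ u₂ ∷ y ∷ u₁ ∷ z ∷ u₂ ∷ γ) → y ∈ γ × y ⨯ u₁ × y ⨯ u₂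
    linked-middle {u₁} {x} {u₂} {y} {z} {γ} r = y∈γ , ⨯-sym u₁⨯y , ⨯-sym (chord₃⇐ r₂ (here refl))
      where
      r₂ : Rep (u₂ ∷ y ∷ u₁ ∷ z ∷ u₂ ∷ γ ++ u₁ ∷ x ∷ [])
      r₂ = rotate (u₁ ∷ x ∷ []) r
      u₁⨯y : u₁ ⨯ y
      u₁⨯y = chord₃⇐ r (there (there (here refl)))
      y∈γ : y ∈ γ
      y∈γ with chord-unique r₂ | proj₂ (crosses⇒ends (x ∷ u₂ ∷ y ∷ []) r u₁⨯y)
      ... | (_ ∷ y≢z ∷ []) ∷ _ | here refl         = contradiction refl y≢z
      ... | _                  | there (here refl) = contradiction (here refl) (end∉ (y ∷ u₁ ∷ z ∷ []) r₂)
      ... | _                  | there (there y∈)  = y∈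

  opaque
    -- Used to exclude exceptional arcs wherever fewer than three letters can occur once.
    exceptional-singles : ∀ {A} → Exceptional A → Arc A →
      ∃[ x ] ∃[ y ] ∃[ z ] Unique (x ∷ y ∷ z ∷ []) × All (λ t → occ t A ≡ 1) (x ∷ y ∷ z ∷ [])
    exceptional-singles (triple {u} {x} {y} {z}) (γ , r) = x , y , z , chord-unique r , All.tabulate single
      where
      single : ∀ {t} → t ∈ x ∷ y ∷ z ∷ [] → occ t (u ∷ x ∷ y ∷ z ∷ u ∷ []) ≡ 1
      single t∈ = split-once (u ∷ x ∷ y ∷ z ∷ u ∷ []) r (there (∈-++⁺ˡ t∈))
        (proj₂ (crosses⇒ends (x ∷ y ∷ z ∷ []) r (chord₃⇐ r t∈)))
    exceptional-singles (linked {u₁} {x} {u₂} {y} {z} x≢z) (γ , r) with chord-unique r | chord-unique (rotate (u₁ ∷ x ∷ []) r)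
    ... | (x≢u₂ ∷ x≢y ∷ []) ∷ _ | (y≢u₁ ∷ y≢z ∷ []) ∷ (u₁≢z ∷ []) ∷ _ =
      x , y , z , (x≢y ∷ x≢z ∷ []) ∷ (y≢z ∷ []) ∷ [] ∷ [] ,
      split-once A r (there (here refl)) x∈γ ∷
      split-once A r (there (there (there (here refl)))) (proj₁ (linked-middle r)) ∷
      split-once A r (there (there (there (there (there (here refl)))))) z∈γ ∷ []
      where
      A : Word
      A = u₁ ∷ x ∷ u₂ ∷ y ∷ u₁ ∷ z ∷ u₂ ∷ []
      r₂ : Rep (u₂ ∷ y ∷ u₁ ∷ z ∷ u₂ ∷ γ ++ u₁ ∷ x ∷ [])
      r₂ = rotate (u₁ ∷ x ∷ []) r
      x∈γ : x ∈ γ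
      x∈γ with proj₂ (crosses⇒ends (x ∷ u₂ ∷ y ∷ []) r (chord₃⇐ r (here refl)))
      ... | here x≡z          = contradiction x≡z x≢z
      ... | there (here x≡u₂) = contradiction x≡u₂ x≢u₂
      ... | there (there x∈)  = x∈
      z∈γ : z ∈ γ
      z∈γ with ∈-++⁻ γ (proj₂ (crosses⇒ends (y ∷ u₁ ∷ z ∷ []) r₂ (chord₃⇐ r₂ (there (there (here refl))))))
      ... | inj₁ z∈                  = z∈
      ... | inj₂ (here z≡u₁)         = contradiction (≡-sym z≡u₁) u₁≢z
      ... | inj₂ (there (here z≡x))  = contradiction (≡-sym z≡x) x≢z

  -- Wheels and the two arcs cut off by the hub.

  Sparse : ℕ → Word → Set
  Sparse s A = (∀ {t} → occ t A ≡ 1 → t ≡ s) × ∃[ w ] 2 ≤ occ w A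

  wheelWord : (v u₁ x u₂ y z : ℕ) → Word
  wheelWord v u₁ x u₂ y z = v ∷ u₁ ∷ x ∷ u₂ ∷ y ∷ u₁ ∷ z ∷ u₂ ∷ v ∷ []

  module Hub {v u₁ x u₂ y z : ℕ} where

    K : Word
    K = wheelWord v u₁ x u₂ y z

    opaque
      hub∈ : ∀ {δ} → Rep (K ++ δ) → y ∈ δ
      hub∈ {δ} r with proj₁ (linked-middle (rotate [ v ] r))
      ... | here refl = contradiction (there (there (there (here refl)))) (end∉ (u₁ ∷ x ∷ u₂ ∷ y ∷ u₁ ∷ z ∷ u₂ ∷ []) r)
      ... | there y∈ with ∈-++⁻ δ y∈
      ...   | inj₁ y∈δ = y∈δ
      ...   | inj₂ (here refl) = contradiction (there (there (there (here refl)))) (end∉ (u₁ ∷ x ∷ u₂ ∷ y ∷ u₁ ∷ z ∷ u₂ ∷ []) r)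

    module _ {D E} (r : Rep (K ++ D ++ y ∷ E)) where

      private
        Bv By : Word
        Bv = u₁ ∷ x ∷ u₂ ∷ y ∷ u₁ ∷ z ∷ u₂ ∷ []
        r₁ = rotate (v ∷ []) r
        r₂ = rotate (v ∷ u₁ ∷ x ∷ []) r
        By = u₁ ∷ z ∷ u₂ ∷ v ∷ D

        opaque
          ry : Rep (y ∷ By ++ y ∷ (E ++ v ∷ u₁ ∷ x ∷ u₂ ∷ []))
          ry = subst (λ V → Rep (y ∷ u₁ ∷ z ∷ u₂ ∷ v ∷ V)) (++-assoc D (y ∷ E) _) (rotate (v ∷ u₁ ∷ x ∷ u₂ ∷ []) r)

        v≢ : ∀ {t} → t ∈ Bv → t ≢ v
        v≢ t∈ refl = end∉ Bv r t∈

        spokes : Unique (u₁ ∷ u₂ ∷ v ∷ [])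
        spokes = ((λ { refl → end∉ (x ∷ u₂ ∷ y ∷ []) r₁ (there (here refl)) }) ∷ v≢ (here refl) ∷ [])
               ∷ (v≢ (there (there (here refl))) ∷ []) ∷ [] ∷ []

        opaque
          y⨯spokes : All (y ⨯_) (u₁ ∷ u₂ ∷ v ∷ [])
          y⨯spokes with y⨯u₁ , y⨯u₂ ← proj₂ (linked-middle r₁) = y⨯u₁ ∷ y⨯u₂ ∷
            ⨯-sym (ends⇒crosses Bv r (there (there (there (here refl)))) (∈-++⁺ʳ D (here refl))) ∷ []

        opaque
          -- The three distinct spokes already exhaust the neighbours of `y`.
          y⨯⇒spoke : ∀ {t} → y ⨯ t → t ∈ u₁ ∷ u₂ ∷ v ∷ []
          y⨯⇒spoke {t} y⨯t with t ∈? (u₁ ∷ u₂ ∷ v ∷ [])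
          ... | yes t∈ = t∈
          ... | no  t∉ = ⊥-elim (crowded (letter ry (here refl)) (unique-∷ t∉ spokes) (y⨯t ∷ y⨯spokes) ≤-refl)

        opaque
          spoke∉D : ∀ {t} → t ∈ u₁ ∷ u₂ ∷ v ∷ [] → t ∉ D
          spoke∉D (here refl) t∈ = end∉ʳ (x ∷ u₂ ∷ y ∷ []) r₁ (there (there (there (∈-++⁺ˡ (∈-++⁺ˡ t∈)))))
          spoke∉D (there (here refl)) t∈ = end∉ʳ (y ∷ u₁ ∷ z ∷ []) r₂ (there (∈-++⁺ˡ (∈-++⁺ˡ t∈)))
          spoke∉D (there (there (here refl))) t∈ = end∉ʳ Bv r (∈-++⁺ˡ t∈)

        u₁≢z : u₁ ≢ z
        u₁≢z with _ ∷ (u₁≢z ∷ []) ∷ _ ← chord-unique r₂ = u₁≢z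

        z∉spokes : z ∉ u₁ ∷ u₂ ∷ v ∷ []
        z∉spokes (here z≡u₁) = u₁≢z (≡-sym z≡u₁)
        z∉spokes (there (here refl)) = end∉ (y ∷ u₁ ∷ z ∷ []) r₂ (there (there (here refl)))
        z∉spokes (there (there (here z≡v))) = v≢ (there (there (there (there (there (here refl)))))) z≡v

      opaque
        hub∉ : y ∉ D
        hub∉ y∈ = end∉ By ry (there (there (there (there y∈))))

      opaque
        -- The chord `y` encloses `u₁ z u₂ v` followed by `D`. A lone letter of `D` other than `z`
        -- would cross `y` and so be a spoke, but the spokes have both ends in the wheel.
        left-single : ∀ {t} → occ t D ≡ 1 → t ≡ z
        left-single {t} eq with z ≟ t
        ... | yes z≡t = ≡-sym z≡t
        ... | no  z≢t = contradiction t∈D (spoke∉D (y⨯⇒spoke (once⇒crosses By ry once)))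
          where
          t∈D : t ∈ D
          t∈D = once⇒∈ D eq
          once : occ t By ≡ 1
          once = trans (occ-skip (u₁ ∷ z ∷ u₂ ∷ v ∷ []) D λ where
            (here refl)                         → spoke∉D (here refl) t∈D
            (there (here t≡z))                  → z≢t (≡-sym t≡z)
            (there (there (here refl)))         → spoke∉D (there (here refl)) t∈D
            (there (there (there (here refl)))) → spoke∉D (there (there (here refl))) t∈D) eq

      opaque
        -- Otherwise `z` would have just one end under the chord `y` and would cross it without
        -- being a spoke.
        z∈left : z ∈ D
        z∈left with z ∈? D
        ... | yes z∈ = z∈
        ... | no  z∉ = contradiction (y⨯⇒spoke (once⇒crosses By ry once)) z∉spokes
          where
          once : occ z By ≡ 1
          once = trans (occ-there {y = u₁} (z ∷ u₂ ∷ v ∷ D) u₁≢z) (trans (occ-here z (u₂ ∷ v ∷ D)) (cong suc (∉⇒occ (u₂ ∷ v ∷ D) λ where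
            (here z≡u₂)         → z∉spokes (there (here z≡u₂))
            (there (here z≡v))  → z∉spokes (there (there (here z≡v)))
            (there (there z∈))  → z∉ z∈)))

      opaque
        -- From its end in the wheel, the chord `z` passes `u₂`, `v` and then `P`, so its third
        -- neighbour lies in `P` and, not being `z`, occurs twice in `D`. Its place in `P` matters
        -- when only an initial part of `D` is available.
        left-full : ∀ P Q → D ≡ P ++ z ∷ Q → ∃[ w ] w ∈ P × 2 ≤ occ w D
        left-full P Q D≡ = third
          where
          rz : Rep (z ∷ (u₂ ∷ v ∷ P) ++ z ∷ Q ++ y ∷ E ++ v ∷ u₁ ∷ x ∷ u₂ ∷ y ∷ u₁ ∷ [])
          rz = subst (λ V → Rep (z ∷ u₂ ∷ v ∷ V))
            (trans (++-assoc D (y ∷ E) _) (trans (cong (_++ y ∷ E ++ _) D≡) (++-assoc P (z ∷ Q) _)))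
            (rotate (v ∷ u₁ ∷ x ∷ u₂ ∷ y ∷ u₁ ∷ []) r)
          third : ∃[ w ] w ∈ P × 2 ≤ occ w D
          third
            with w , z⨯w , w∉ ← another (u₂ ∷ v ∷ []) (letter rz (here refl)) ≤-refl
            with proj₁ (crosses⇒ends (u₂ ∷ v ∷ P) rz z⨯w)
          ... | here w≡u₂         = contradiction (here w≡u₂) w∉
          ... | there (here w≡v)  = contradiction (there (here w≡v)) w∉
          ... | there (there w∈P) = w , w∈P , ≤∧≢⇒< (∈⇒occ w∈D) λ 1≡occ →
                end∉ (u₂ ∷ v ∷ P) rz (there (there (subst (_∈ P) (left-single (≡-sym 1≡occ)) w∈P)))
            where
            w∈D : w ∈ D
            w∈D = subst (w ∈_) (≡-sym D≡) (∈-++⁺ˡ w∈P)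

      opaque
        left-sparse : Sparse z D
        left-sparse with P , Q , D≡ ← ∈-∃++ z∈left with w , _ , 2≤ ← left-full P Q D≡ = left-single , w , 2≤

      opaque
        left-arc : Arc D
        left-arc = _ , subst Rep (++-assoc D (y ∷ E) K) (rotate K r)

      opaque
        right-arc : Arc E
        right-arc = _ , rotate (K ++ D ++ [ y ])
          (subst (λ V → Rep (K ++ V)) (≡-sym (++-assoc D [ y ] E)) r)

  opaque
    reverse-wheel : ∀ v u₁ x u₂ y z D E → reverse (wheelWord v u₁ x u₂ y z ++ D ++ y ∷ E) ≡
                    (reverse E ++ y ∷ reverse D) ++ wheelWord v u₂ z u₁ y x
    reverse-wheel v u₁ x u₂ y z D E =
      trans (reverse-++ (wheelWord v u₁ x u₂ y z) (D ++ y ∷ E)) (cong (_++ wheelWord v u₂ z u₁ y x) eq)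
      where
      eq : reverse (D ++ y ∷ E) ≡ reverse E ++ y ∷ reverse D
      eq = trans (reverse-++ D (y ∷ E))
             (trans (cong (_++ reverse D) (unfold-reverse y E)) (++-assoc (reverse E) [ y ] (reverse D)))

  opaque
    -- Reversal gives a wheel again, with `u₁`, `x` and `D` exchanged for `u₂`, `z` and `E`, so
    -- facts about the left arc carry over to the right one.
    mirror : ∀ {v u₁ x u₂ y z} D {E} → Rep (wheelWord v u₁ x u₂ y z ++ D ++ y ∷ E) →
             Rep (wheelWord v u₂ z u₁ y x ++ reverse E ++ y ∷ reverse D)
    mirror {v} {u₁} {x} {u₂} {y} {z} D {E} r =
      rotate (reverse E ++ y ∷ reverse D) (subst Rep (reverse-wheel v u₁ x u₂ y z D E) (flip r))

  opaque
    sparse-reverse : ∀ {s} A → Sparse s (reverse A) → Sparse s A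
    sparse-reverse A (single , w , 2≤) =
      (λ {t} eq → single (trans (occ-reverse t A) eq)) , w , subst (2 ≤_) (occ-reverse w A) 2≤

  opaque
    right-sparse : ∀ {v u₁ x u₂ y z} D {E} → Rep (wheelWord v u₁ x u₂ y z ++ D ++ y ∷ E) → Sparse x E
    right-sparse {v} {u₁} {x} {u₂} {y} {z} D {E} r =
      sparse-reverse E (Hub.left-sparse {v} {u₂} {z} {u₁} {y} {x} {reverse E} {reverse D} (mirror D r))

  -- Sparse arcs contain twins: induction on length.

  sparse-twins : ∀ n A s → length A < n → Arc A → Sparse s A → Has Twinned A
  -- The second end of the hub `y` lies in `β`, in `α` or outside the arc; each case leaves a
  -- shorter sparse arc inside the given one.
  sparse-twins-wheel : ∀ n α β s {v u₁ x u₂ y z} → length (α ++ wheelWord v u₁ x u₂ y z ++ β) < suc n →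
    Arc (α ++ wheelWord v u₁ x u₂ y z ++ β) → Sparse s (α ++ wheelWord v u₁ x u₂ y z ++ β) →
    Has Twinned (α ++ wheelWord v u₁ x u₂ y z ++ β)

  sparse-twins (suc n) A s A<n arc sparse@(single , full)
    -- The only possible lone letter is repeated because `dissect` asks for a budget of length
    -- three.
    with dissect (suc n) A (s ∷ s ∷ s ∷ []) A<n arc refl (here ∘ single) full
  ... | inj₁ h = h
  ... | inj₂ (inj₁ (at α β wheel)) = sparse-twins-wheel n α β s A<n arc sparse
  ... | inj₂ (inj₂ e) with _ , _ , _ , (x≢y ∷ _) ∷ _ , x₁ ∷ y₁ ∷ _ ← exceptional-singles e arc =
    contradiction (trans (single x₁) (≡-sym (single y₁))) x≢y

  sparse-twins-wheel n α β s {v} {u₁} {x} {u₂} {y} {z} A<n (γ , rep) (single , _) =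
    locate (∈-++⁻ β (Hub.hub∈ r))
    where
    K = wheelWord v u₁ x u₂ y z
    A = α ++ K ++ β
    r : Rep (K ++ β ++ γ ++ α)
    r = rep-factor α K β rep

    β<n : length β < n
    β<n = ≤-trans (s≤s (length-++-≤ʳ β {u₁ ∷ x ∷ u₂ ∷ y ∷ u₁ ∷ z ∷ u₂ ∷ v ∷ []}))
            (≤-trans (length-++-≤ʳ (K ++ β) {α}) (s≤s⁻¹ A<n))

    α<n : length α < n
    α<n = ≤-trans (≤-trans (s≤s (length-++-≤ˡ α)) (≤-reflexive (≡-sym (length-++-sucʳ α v _)))) (s≤s⁻¹ A<n)

    via-left : ∀ {D E} → Rep (K ++ D ++ y ∷ E) → length D < n → Has Twinned D
    via-left {D} r D<n = sparse-twins n D z D<n (Hub.left-arc r) (Hub.left-sparse r)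

    -- Here `y` leaves the arc and is therefore its only lone letter. So no chord joins `β` to `γ₁`,
    -- and `β` inherits sparseness from the left arc `β ++ γ₁`.
    outside : y ∈ γ → Has Twinned β
    outside y∈γ with γ₁ , γ₂ , γ≡ ← ∈-∃++ y∈γ =
      sparse-twins n β z β<n (_ , subst Rep (++-assoc β (γ ++ α) K) (rotate K r)) (β-single , β-full)
      where
      D = β ++ γ₁
      rD : Rep (K ++ D ++ y ∷ γ₂ ++ α)
      rD = subst (λ V → Rep (K ++ V)) (trans (cong (λ V → β ++ V ++ α) γ≡)
             (trans (cong (β ++_) (++-assoc γ₁ (y ∷ γ₂) α)) (≡-sym (++-assoc β γ₁ _)))) r
      y∈A : y ∈ A
      y∈A = ∈-++⁺ʳ α (there (there (there (there (here refl)))))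
      β∌γ₁ : ∀ {t} → t ∈ β → t ∉ γ₁
      β∌γ₁ {t} t∈β t∈γ₁ = Hub.hub∉ rD (subst (_∈ D) t≡y (∈-++⁺ˡ t∈β))
        where
        t≡y : t ≡ y
        t≡y = trans (single (split-once A rep (∈-++⁺ʳ α (∈-++⁺ʳ K t∈β)) (subst (t ∈_) (≡-sym γ≡) (∈-++⁺ˡ t∈γ₁))))
                    (≡-sym (single (split-once A rep y∈A y∈γ)))
      occ-β : ∀ {t} → t ∈ β → occ t D ≡ occ t β
      occ-β {t} t∈β = trans (occ-comm t β γ₁) (occ-skip γ₁ β (β∌γ₁ t∈β))
      β-single : ∀ {t} → occ t β ≡ 1 → t ≡ z
      β-single eq = Hub.left-single rD (trans (occ-β (once⇒∈ β eq)) eq)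
      z∈β : z ∈ β
      z∈β with ∈-++⁻ β (Hub.z∈left rD)
      ... | inj₁ z∈β = z∈β
      ... | inj₂ z∈γ₁ = contradiction (subst (_∈ D) z≡y (Hub.z∈left rD)) (Hub.hub∉ rD)
        where
        z≡y : z ≡ y
        z≡y = trans (single (split-once A rep (∈-++⁺ʳ α (there (there (there (there (there (there (here refl))))))))
                              (subst (z ∈_) (≡-sym γ≡) (∈-++⁺ˡ z∈γ₁))))
                    (≡-sym (single (split-once A rep y∈A y∈γ)))
      β-full : ∃[ w ] 2 ≤ occ w β
      β-full with P , Q , β≡ ← ∈-∃++ z∈β
        with w , w∈P , 2≤ ← Hub.left-full rD P (Q ++ γ₁) (trans (cong (_++ γ₁) β≡) (++-assoc P (z ∷ Q) γ₁)) =
        w , subst (2 ≤_) (occ-β (subst (w ∈_) (≡-sym β≡) (∈-++⁺ˡ w∈P))) 2≤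

    locate : y ∈ β ⊎ y ∈ γ ++ α → Has Twinned A
    locate (inj₁ y∈β) with D , E , β≡ ← ∈-∃++ y∈β =
      has-++ˡ α (has-++ˡ K (subst (Has Twinned) (≡-sym β≡) (has-++ʳ (y ∷ E)
        (via-left (subst (λ V → Rep (K ++ V)) (trans (cong (_++ γ ++ α) β≡) (++-assoc D (y ∷ E) _)) r)
          (≤-trans (s≤s (≤-trans (length-++-≤ˡ D) (≤-reflexive (cong length (≡-sym β≡))))) β<n)))))
    locate (inj₂ y∈) with ∈-++⁻ γ y∈
    ... | inj₁ y∈γ = has-++ˡ α (has-++ˡ K (outside y∈γ))
    -- Going round the circle from the wheel, one meets `β`, `γ` and `F` before `y`; the right arc
    -- `E` is the rest of `α`.
    ... | inj₂ y∈α with F , E , α≡ ← ∈-∃++ y∈α =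
      has-++ʳ (K ++ β) (subst (Has Twinned) (≡-sym α≡) (has-++ˡ F (has-∷ y
        (sparse-twins n E x E<n (Hub.right-arc {D = β ++ γ ++ F} rE) (right-sparse (β ++ γ ++ F) rE)))))
      where
      rE : Rep (K ++ (β ++ γ ++ F) ++ y ∷ E)
      rE = subst (λ V → Rep (K ++ V)) (trans (cong (λ V → β ++ γ ++ V) α≡)
             (trans (cong (β ++_) (≡-sym (++-assoc γ F (y ∷ E)))) (≡-sym (++-assoc β (γ ++ F) (y ∷ E))))) r
      E<n : length E < n
      E<n = ≤-trans (s≤s (≤-trans (length-++-≤ʳ E {F ++ [ y ]})
              (≤-reflexive (cong length (trans (++-assoc F [ y ] E) (≡-sym α≡)))))) α<n

  -- Twin letters and disjoint pairs of them.

  Twin : ℕ → ℕ → Set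
  Twin a b = a ≢ b × ∀ {t} → t ≢ a → t ≢ b → (a ⨯ t → b ⨯ t) × (b ⨯ t → a ⨯ t)

  TwinPairs : Set
  TwinPairs = ∃[ a ] ∃[ b ] ∃[ c ] ∃[ d ] Twin a b × Twin c d × All (_∈ W₀) (a ∷ b ∷ c ∷ d ∷ []) ×
              a ≢ c × a ≢ d × b ≢ c × b ≢ d

  -- Both chords lie entirely in `A`, so pairs found in disjoint arcs cannot share a letter.
  record FullTwins (A : Word) : Set where
    constructor full-twins
    field
      {a b}  : ℕ
      twin   : Twin a b
      a-full : 2 ≤ occ a A
      b-full : 2 ≤ occ b A

  opaque
    -- Apart from each other, `u` and `w` both have the neighbours `a` and `b`.
    adjacent-twin : ∀ {u w a b γ} → Rep (u ∷ w ∷ a ∷ b ∷ u ∷ w ∷ γ) → Twin u w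
    adjacent-twin {u} {w} {a} {b} {γ} r = u≢w , tw
      where
      r′ : Rep (w ∷ a ∷ b ∷ u ∷ w ∷ γ ++ [ u ])
      r′ = rotate [ u ] r
      u≢w : u ≢ w
      u≢w refl = end∉ (u ∷ a ∷ b ∷ []) r (here refl)
      tw : ∀ {t} → t ≢ u → t ≢ w → (u ⨯ t → w ⨯ t) × (w ⨯ t → u ⨯ t)
      tw {t} t≢u t≢w = (λ u⨯t → to (chord₃⇒ r u⨯t)) , (λ w⨯t → from (chord₃⇒ r′ w⨯t))
        where
        to : t ∈ w ∷ a ∷ b ∷ [] → w ⨯ t
        to (here e)                 = contradiction e t≢w
        to (there (here e))         = chord₃⇐ r′ (here e)
        to (there (there (here e))) = chord₃⇐ r′ (there (here e))
        from : t ∈ a ∷ b ∷ u ∷ [] → u ⨯ t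
        from (here e)                 = chord₃⇐ r (there (here e))
        from (there (here e))         = chord₃⇐ r (there (there (here e)))
        from (there (there (here e))) = contradiction e t≢u

  opaque
    -- Both chords have the neighbours `x`, `y`, `z`: a letter crossing `u` has its other end beyond
    -- `u`, hence beyond the adjoining `v`.
    nested-twin : ∀ {v u x y z γ} → Rep (v ∷ u ∷ x ∷ y ∷ z ∷ u ∷ v ∷ γ) → Twin v u
    nested-twin {v} {u} {x} {y} {z} {γ} r = v≢u , tw
      where
      r′ : Rep (u ∷ x ∷ y ∷ z ∷ u ∷ v ∷ γ ++ [ v ])
      r′ = rotate [ v ] r
      v≢u : v ≢ u
      v≢u refl = end∉ (v ∷ x ∷ y ∷ z ∷ v ∷ []) r (here refl)
      tw : ∀ {t} → t ≢ v → t ≢ u → (v ⨯ t → u ⨯ t) × (u ⨯ t → v ⨯ t)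
      tw {t} t≢v t≢u = (λ v⨯t → to (proj₁ (crosses⇒ends (u ∷ x ∷ y ∷ z ∷ u ∷ []) r v⨯t))) , from
        where
        to : t ∈ u ∷ x ∷ y ∷ z ∷ u ∷ [] → u ⨯ t
        to (here e)                                 = contradiction e t≢u
        to (there (here e))                         = chord₃⇐ r′ (here e)
        to (there (there (here e)))                 = chord₃⇐ r′ (there (here e))
        to (there (there (there (here e))))         = chord₃⇐ r′ (there (there (here e)))
        to (there (there (there (there (here e))))) = contradiction e t≢u
        from : u ⨯ t → v ⨯ t
        from u⨯t with t∈ , t∈γ ← crosses⇒ends (x ∷ y ∷ z ∷ []) r′ u⨯t with t∈γ
        ... | here t≡v = contradiction t≡v t≢v
        ... | there t∈′ with ∈-++⁻ γ t∈′
        ...   | inj₁ t∈γ′ = ends⇒crosses (u ∷ x ∷ y ∷ z ∷ u ∷ []) r (there (∈-++⁺ˡ t∈)) t∈γ′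
        ...   | inj₂ (here t≡v) = contradiction t≡v t≢v

  opaque
    twinned-twins : ∀ {T γ} → Twinned T → Rep (T ++ γ) → FullTwins T
    twinned-twins (adjacent {u} {w} {a} {b}) r = full-twins (adjacent-twin r)
      (twice u (w ∷ a ∷ b ∷ u ∷ w ∷ []) (there (there (there (here refl)))))
      (≤-trans (twice w (a ∷ b ∷ u ∷ w ∷ []) (there (there (there (here refl))))) (occ-≤ʳ w [ u ] (w ∷ a ∷ b ∷ u ∷ w ∷ [])))
    twinned-twins (nested {v} {u} {x} {y} {z}) r = full-twins (nested-twin r)
      (twice v (u ∷ x ∷ y ∷ z ∷ u ∷ v ∷ []) (there (there (there (there (there (here refl)))))))
      (≤-trans (twice u (x ∷ y ∷ z ∷ u ∷ v ∷ []) (there (there (there (here refl))))) (occ-≤ʳ u [ v ] (u ∷ x ∷ y ∷ z ∷ u ∷ v ∷ [])))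

  opaque
    arc-twins : ∀ {A} → Arc A → Has Twinned A → FullTwins A
    arc-twins (γ , r) (at α {T} β p) with full-twins tw a2 b2 ← twinned-twins p (rep-factor α T β r) =
      full-twins tw (≤-trans a2 (grow _)) (≤-trans b2 (grow _))
      where
      grow : ∀ t → occ t T ≤ occ t (α ++ T ++ β)
      grow t = ≤-trans (occ-≤ˡ t T β) (occ-≤ʳ t α (T ++ β))

  opaque
    disjoint-pairs : ∀ A {B γ} → Rep (A ++ γ) → (∀ {t} → t ∈ B → t ∈ γ) → FullTwins A → FullTwins B → TwinPairs
    disjoint-pairs A {B} {γ} r B⊆γ (full-twins {a} {b} t₁ a2 b2) (full-twins {c} {d} t₂ c2 d2) =
      a , b , c , d , t₁ , t₂ , inA a2 ∷ inA b2 ∷ inB c2 ∷ inB d2 ∷ [] , apart a2 c2 , apart a2 d2 , apart b2 c2 , apart b2 d2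
      where
      full⇒∈ : ∀ {t} C → 2 ≤ occ t C → t ∈ C
      full⇒∈ C 2≤ = occ⇒∈ C (≤-trans (s≤s z≤n) 2≤)
      inA : ∀ {t} → 2 ≤ occ t A → t ∈ W₀
      inA 2≤ = letter r (∈-++⁺ˡ (full⇒∈ A 2≤))
      inB : ∀ {t} → 2 ≤ occ t B → t ∈ W₀
      inB 2≤ = letter r (∈-++⁺ʳ A (B⊆γ (full⇒∈ B 2≤)))
      apart : ∀ {p q} → 2 ≤ occ p A → 2 ≤ occ q B → p ≢ q
      apart p2 q2 refl = full⇒outside A r p2 (B⊆γ (full⇒∈ B q2))

  opaque
    -- The two arcs cut off by the hub are disjoint and sparse, so each contributes a pair.
    wheel-pairs : ∀ {v u₁ x u₂ y z δ} → Rep (wheelWord v u₁ x u₂ y z ++ δ) → TwinPairs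
    wheel-pairs {v} {u₁} {x} {u₂} {y} {z} r with D , E , refl ← ∈-∃++ (Hub.hub∈ r) =
      disjoint-pairs D (subst Rep (++-assoc D (y ∷ E) _) (rotate (wheelWord v u₁ x u₂ y z) r)) (there ∘ ∈-++⁺ˡ)
        (arc-twins left (sparse-twins _ D z ≤-refl left (Hub.left-sparse r)))
        (arc-twins right (sparse-twins _ E x ≤-refl right (right-sparse D r)))
      where
      left : Arc D
      left = Hub.left-arc r
      right : Arc E
      right = Hub.right-arc {D = D} r

  opaque
    ⨯-irrefl : ∀ {x} → ¬ x ⨯ x
    ⨯-irrefl {x} x⨯x = contradiction (≤-trans three (≤-trans (⊆⇒occ (subword x⨯x)) (occ≤2 self x))) λ { (s≤s (s≤s ())) }
      where
      subword : x ⨯ x → (x ∷ x ∷ x ∷ x ∷ []) ⊆ W₀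
      subword (inj₁ p) = p
      subword (inj₂ p) = p
      three : 3 ≤ occ x (x ∷ x ∷ x ∷ x ∷ [])
      three = subst (3 ≤_) (≡-sym (occ-here x (x ∷ x ∷ x ∷ []))) (s≤s (twice x (x ∷ x ∷ []) (here refl)))

  -- Twins in the complement join those in `T`; a wheel there supplies both pairs by itself.
  further-pair : ∀ T {C} → Rep (T ++ C) → FullTwins T → Has Twinned C ⊎ Has Wheel C → TwinPairs
  further-pair T r tw (inj₁ h)               = disjoint-pairs T r id tw (arc-twins (T , rotate T r) h)
  further-pair T r tw (inj₂ (at α β wheel))  = wheel-pairs (rep-factor α _ β (rotate T r))

  -- The complement of an adjacent twin pair.

  module Adjacent {u w a b C} (r : Rep (u ∷ w ∷ a ∷ b ∷ u ∷ w ∷ C)) where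

    T : Word
    T = u ∷ w ∷ a ∷ b ∷ u ∷ w ∷ []

    r₂ : Rep (w ∷ a ∷ b ∷ u ∷ w ∷ C ++ [ u ])
    r₂ = rotate [ u ] r

    -- The other end lies in `T`, where `u` and `w` have both of their ends already.
    legs : ∀ {t} → occ t C ≡ 1 → t ∈ a ∷ b ∷ []
    legs {t} eq with once-split C (rotate T r) eq
    ... | here refl                                 = contradiction (there (once⇒∈ C eq)) (end∉ʳ (w ∷ a ∷ b ∷ []) r)
    ... | there (here refl)                         = contradiction (∈-++⁺ˡ (once⇒∈ C eq)) (end∉ʳ (a ∷ b ∷ u ∷ []) r₂)
    ... | there (there (here e))                    = here e
    ... | there (there (there (here e)))            = there (here e)
    ... | there (there (there (there (here refl)))) = contradiction (there (once⇒∈ C eq)) (end∉ʳ (w ∷ a ∷ b ∷ []) r)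
    ... | there (there (there (there (there (here refl))))) = contradiction (∈-++⁺ˡ (once⇒∈ C eq)) (end∉ʳ (a ∷ b ∷ u ∷ []) r₂)

    no-exception : ¬ Exceptional C
    no-exception e with _ , _ , _ , uniq , once ← exceptional-singles e (T , rotate T r) =
      contradiction (pigeonhole uniq (legs ∘ All.lookup once)) λ { (s≤s (s≤s ())) }

    -- With no chord inside `C`, there are no letters besides `u`, `w`, `a`, `b`: the graph is the
    -- complete graph on four vertices.
    complete-pairs : Unique C → TwinPairs
    complete-pairs uC = u , w , a , b , adjacent-twin r , (a≢b , λ t≢a t≢b →
        (λ a⨯t → b⨯ (others (⨯-letter a⨯t) t≢a t≢b)) , (λ b⨯t → a⨯ (others (⨯-letter b⨯t) t≢a t≢b))) ,
      letter r (here refl) ∷ letter r (there (here refl)) ∷ letter r (there (there (here refl))) ∷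
        letter r (there (there (there (here refl)))) ∷ [] ,
      (λ { refl → end∉ (w ∷ a ∷ b ∷ []) r (there (here refl)) }) ,
      (λ { refl → end∉ (w ∷ a ∷ b ∷ []) r (there (there (here refl))) }) ,
      (λ { refl → end∉ (a ∷ b ∷ u ∷ []) r₂ (here refl) }) ,
      (λ { refl → end∉ (a ∷ b ∷ u ∷ []) r₂ (there (here refl)) })
      where
      a≢b : a ≢ b
      a≢b with _ ∷ (a≢b ∷ []) ∷ _ ← chord-unique r = a≢b
      others : ∀ {t} → t ∈ W₀ → t ≢ a → t ≢ b → t ∈ u ∷ w ∷ []
      others t∈ t≢a t≢b with ∈-++⁻ T (letter⁻ r t∈)
      ... | inj₁ (here e)                                 = here e
      ... | inj₁ (there (here e))                         = there (here e)
      ... | inj₁ (there (there (here e)))                 = contradiction e t≢a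
      ... | inj₁ (there (there (there (here e))))         = contradiction e t≢b
      ... | inj₁ (there (there (there (there (here e))))) = here e
      ... | inj₁ (there (there (there (there (there (here e)))))) = there (here e)
      ... | inj₂ t∈C with legs (unique⇒once uC t∈C)
      ...   | here e         = contradiction e t≢a
      ...   | there (here e) = contradiction e t≢b
      a⨯ : ∀ {t} → t ∈ u ∷ w ∷ [] → a ⨯ t
      a⨯ (here refl)         = ⨯-sym (chord₃⇐ r (there (here refl)))
      a⨯ (there (here refl)) = ⨯-sym (chord₃⇐ r₂ (here refl))
      b⨯ : ∀ {t} → t ∈ u ∷ w ∷ [] → b ⨯ t
      b⨯ (here refl)         = ⨯-sym (chord₃⇐ r (there (there (here refl))))
      b⨯ (there (here refl)) = ⨯-sym (chord₃⇐ r₂ (there (here refl)))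

    pairs : TwinPairs
    pairs with duplicate? C
    ... | inj₁ uC   = complete-pairs uC
    ... | inj₂ full
      -- The second `b` only pads the budget to length three.
      with dissect _ C (a ∷ b ∷ b ∷ []) ≤-refl (T , rotate T r) refl (∈-++⁺ˡ ∘ legs) full
    ...   | inj₁ h        = further-pair T r (twinned-twins adjacent r) (inj₁ h)
    ...   | inj₂ (inj₁ h) = further-pair T r (twinned-twins adjacent r) (inj₂ h)
    ...   | inj₂ (inj₂ e) = contradiction e no-exception

  -- The complement of a nested twin pair.

  module NestedPair {v u x y z C} (r : Rep (v ∷ u ∷ x ∷ y ∷ z ∷ u ∷ v ∷ C)) where

    T legs : Word
    T    = v ∷ u ∷ x ∷ y ∷ z ∷ u ∷ v ∷ []
    legs = x ∷ y ∷ z ∷ []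

    r₂ : Rep (u ∷ x ∷ y ∷ z ∷ u ∷ v ∷ C ++ [ v ])
    r₂ = rotate [ v ] r

    u∉C : u ∉ C
    u∉C u∈ = end∉ʳ legs r₂ (there (∈-++⁺ˡ u∈))

    v∉C : v ∉ C
    v∉C = end∉ʳ (u ∷ x ∷ y ∷ z ∷ u ∷ []) r

    u≢v : u ≢ v
    u≢v refl = end∉ (u ∷ x ∷ y ∷ z ∷ u ∷ []) r (here refl)

    T-legs : ∀ {t} → t ∈ T → t ≢ u → t ≢ v → t ∈ legs
    T-legs (here e)                                         t≢u t≢v = contradiction e t≢v
    T-legs (there (here e))                                 t≢u t≢v = contradiction e t≢u
    T-legs (there (there (here e)))                         _   _   = here e
    T-legs (there (there (there (here e))))                 _   _   = there (here e)
    T-legs (there (there (there (there (here e)))))         _   _   = there (there (here e))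
    T-legs (there (there (there (there (there (here e)))))) t≢u t≢v = contradiction e t≢u
    T-legs (there (there (there (there (there (there (here e))))))) t≢u t≢v = contradiction e t≢v

    once-legs : ∀ {t} → occ t C ≡ 1 → t ∈ legs
    once-legs eq = T-legs (once-split C (rotate T r) eq)
      (λ { refl → u∉C (once⇒∈ C eq) }) (λ { refl → v∉C (once⇒∈ C eq) })

    leg∈C : ∀ {t} → t ∈ legs → t ∈ C
    leg∈C t∈ with proj₂ (crosses⇒ends legs r₂ (chord₃⇐ r₂ t∈))
    ... | here refl = contradiction (there (∈-++⁺ˡ t∈)) (end∉ (u ∷ x ∷ y ∷ z ∷ u ∷ []) r)
    ... | there t∈′ with ∈-++⁻ C t∈′
    ...   | inj₁ t∈C         = t∈C
    ...   | inj₂ (here refl) = contradiction (there (∈-++⁺ˡ t∈)) (end∉ (u ∷ x ∷ y ∷ z ∷ u ∷ []) r)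

    leg⨯u : ∀ {t} → t ∈ legs → t ⨯ u
    leg⨯u t∈ = ⨯-sym (chord₃⇐ r₂ t∈)

    leg⨯v : ∀ {t} → t ∈ legs → t ⨯ v
    leg⨯v t∈ = ⨯-sym (ends⇒crosses (u ∷ x ∷ y ∷ z ∷ u ∷ []) r (there (∈-++⁺ˡ t∈)) (leg∈C t∈))

    -- Each leg already has the neighbours `u` and `v`, so there is room for only one more.
    leg-crowded : ∀ {t p q} → t ∈ legs → p ∉ u ∷ v ∷ [] → q ∉ u ∷ v ∷ [] → p ≢ q → t ⨯ p → t ⨯ q → ⊥
    leg-crowded t∈ p∉ q∉ p≢q t⨯p t⨯q = crowded (⨯-letter (chord₃⇐ r₂ t∈))
      (unique-∷ (λ { (here p≡q) → p≢q p≡q ; (there p∈) → p∉ p∈ }) (unique-∷ q∉ ((u≢v ∷ []) ∷ [] ∷ [])))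
      (t⨯p ∷ t⨯q ∷ leg⨯u t∈ ∷ leg⨯v t∈ ∷ []) ≤-refl

    leg∉ : ∀ {t} → t ∈ legs → t ∉ u ∷ v ∷ []
    leg∉ t∈ (here refl)         = end∉ legs r₂ t∈
    leg∉ t∈ (there (here refl)) = v∉C (leg∈C t∈)

    C∉ : ∀ {t} → t ∈ C → t ∉ u ∷ v ∷ []
    C∉ t∈ (here refl)         = u∉C t∈
    C∉ t∈ (there (here refl)) = v∉C t∈

    -- With no chord inside `C`, the third neighbour of every leg would be a leg, giving a perfect
    -- matching on three vertices.
    ¬unique : ¬ Unique C
    ¬unique uC with (x≢y ∷ x≢z ∷ []) ∷ (y≢z ∷ []) ∷ _ ← chord-unique r₂ = conflict (third (here refl))
      where
      third : ∀ {t} → t ∈ legs → ∃[ s ] t ⨯ s × s ∈ legs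
      third t∈ with s , t⨯s , s∉ ← another (u ∷ v ∷ []) (⨯-letter (chord₃⇐ r₂ t∈)) ≤-refl
        with ∈-++⁻ T (letter⁻ r (⨯-letter t⨯s))
      ... | inj₁ s∈T = s , t⨯s , T-legs s∈T (s∉ ∘ here) (s∉ ∘ there ∘ here)
      ... | inj₂ s∈C = s , t⨯s , once-legs (unique⇒once uC s∈C)
      crowd : ∀ {t p q} → t ∈ legs → p ∈ legs → q ∈ legs → p ≢ q → t ⨯ p → t ⨯ q → ⊥
      crowd t∈ p∈ q∈ = leg-crowded t∈ (leg∉ p∈) (leg∉ q∈)
      x∈ : x ∈ legs
      x∈ = here refl
      y∈ : y ∈ legs
      y∈ = there (here refl)
      z∈ : z ∈ legs
      z∈ = there (there (here refl))
      conflict : ∃[ s ] x ⨯ s × s ∈ legs → ⊥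
      conflict (_ , x⨯s , here refl) = ⨯-irrefl x⨯s
      conflict (_ , x⨯y , there (here refl)) with third z∈
      ... | _ , z⨯x , here refl                 = crowd x∈ y∈ z∈ y≢z x⨯y (⨯-sym z⨯x)
      ... | _ , z⨯y , there (here refl)         = crowd y∈ x∈ z∈ x≢z (⨯-sym x⨯y) (⨯-sym z⨯y)
      ... | _ , z⨯z , there (there (here refl)) = ⨯-irrefl z⨯z
      conflict (_ , x⨯z , there (there (here refl))) with third y∈
      ... | _ , y⨯x , here refl                 = crowd x∈ y∈ z∈ y≢z (⨯-sym y⨯x) x⨯z
      ... | _ , y⨯y , there (here refl)         = ⨯-irrefl y⨯y
      ... | _ , y⨯z , there (there (here refl)) = crowd z∈ x∈ y∈ x≢y (⨯-sym x⨯z) (⨯-sym y⨯z)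

    -- The legs on one side and `u`, `v`, `c` on the other form a complete bipartite component, in
    -- which two legs are twins as well.
    bipartite-pairs : ∀ {c} → c ∉ u ∷ v ∷ [] → (∀ {t} → t ∈ legs → t ⨯ c) → TwinPairs
    bipartite-pairs {c} c∉ leg⨯c = v , u , x , y , nested-twin r ,
      (x≢y , λ _ _ → same (here refl) (there (here refl)) , same (there (here refl)) (here refl)) ,
      letter r (here refl) ∷ letter r (there (here refl)) ∷ letter r (there (there (here refl))) ∷
        letter r (there (there (there (here refl)))) ∷ [] ,
      (λ { refl → leg∉ (here refl) (there (here refl)) }) ,
      (λ { refl → leg∉ (there (here refl)) (there (here refl)) }) ,
      (λ { refl → leg∉ (here refl) (here refl) }) ,
      (λ { refl → leg∉ (there (here refl)) (here refl) })
      where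
      x≢y : x ≢ y
      x≢y with (x≢y ∷ _) ∷ _ ← chord-unique r₂ = x≢y
      same : ∀ {p q t} → p ∈ legs → q ∈ legs → p ⨯ t → q ⨯ t
      same {t = t} p∈ q∈ p⨯t with t ∈? (c ∷ u ∷ v ∷ [])
      ... | yes (here refl)                 = leg⨯c q∈
      ... | yes (there (here refl))         = leg⨯u q∈
      ... | yes (there (there (here refl))) = leg⨯v q∈
      ... | no t∉ = ⊥-elim (leg-crowded p∈ (t∉ ∘ there) c∉ (t∉ ∘ here) p⨯t (leg⨯c p∈))

    -- For `triple`, every leg ends under the chord `c` and crosses it. For `linked`, the middle
    -- letter `q` is a leg and would have the four neighbours `u`, `v`, `u₁`, `u₂`.
    exceptional-pairs : Exceptional C → TwinPairs
    exceptional-pairs (triple {c} {p} {q} {s}) = bipartite-pairs (C∉ (here refl)) leg⨯c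
      where
      rC : Rep (c ∷ p ∷ q ∷ s ∷ c ∷ T)
      rC = rotate T r
      leg⨯c : ∀ {t} → t ∈ legs → t ⨯ c
      leg⨯c t∈ with leg∈C t∈
      ... | here refl = contradiction (there (there (∈-++⁺ˡ t∈))) (end∉ʳ (p ∷ q ∷ s ∷ []) rC)
      ... | there t∈′ with ∈-++⁻ (p ∷ q ∷ s ∷ []) t∈′
      ...   | inj₁ t∈C = ⨯-sym (chord₃⇐ rC t∈C)
      ...   | inj₂ (here refl) = contradiction (there (there (∈-++⁺ˡ t∈))) (end∉ʳ (p ∷ q ∷ s ∷ []) rC)
    exceptional-pairs (linked {u₁} {p} {u₂} {q} {s} _) with q∈T , q⨯u₁ , q⨯u₂ ← linked-middle (rotate T r) =
      ⊥-elim (leg-crowded (T-legs q∈T (λ e → C∉ q∈C (here e)) (λ e → C∉ q∈C (there (here e))))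
        (C∉ (here refl)) (C∉ (there (there (here refl)))) u₁≢u₂ q⨯u₁ q⨯u₂)
      where
      q∈C : q ∈ C
      q∈C = there (there (there (here refl)))
      u₁≢u₂ : u₁ ≢ u₂
      u₁≢u₂ refl = end∉ (p ∷ u₂ ∷ q ∷ []) (rotate T r) (there (here refl))

    pairs : TwinPairs
    pairs with duplicate? C
    ... | inj₁ uC   = contradiction uC ¬unique
    ... | inj₂ full
      with dissect _ C legs ≤-refl (T , rotate T r) refl once-legs full
    ...   | inj₁ h        = further-pair T r (twinned-twins nested r) (inj₁ h)
    ...   | inj₂ (inj₁ h) = further-pair T r (twinned-twins nested r) (inj₂ h)
    ...   | inj₂ (inj₂ e) = exceptional-pairs e

  -- Two disjoint twin pairs in the word.

  twin-pairs : ∀ {x} → x ∈ W₀ → TwinPairs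
  -- No letter occurs exactly once in the whole word, so it is sparse for any choice of the
  -- exceptional letter; `0` is arbitrary.
  twin-pairs {x} x∈ = conclude (sparse-twins _ W₀ 0 ≤-refl ([] , subst Rep (≡-sym (++-identityʳ W₀)) self)
      ((λ {t} eq → contradiction (trans (≡-sym eq) (W₀-double t (once⇒∈ W₀ eq))) λ ()) ,
       x , ≤-reflexive (≡-sym (W₀-double x x∈)))) self
    where
    conclude : ∀ {W} → Has Twinned W → Rep W → TwinPairs
    conclude (at α {T} β p) r = close-up p (rep-factor α T β (subst Rep (≡-sym (++-identityʳ (α ++ T ++ β))) r))
      where
      close-up : ∀ {T C} → Twinned T → Rep (T ++ C) → TwinPairs
      close-up adjacent r = Adjacent.pairs r
      close-up nested   r = NestedPair.pairs r

-- Transfer from letters to vertices.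

module _ {n} (G : SimpleGraph n) (G-cubic : Regular 3 G) {W : Word} (W-double : DoubleOccurrence W)
  {f : Fin n → ℕ} (iso : IsoToInterlacement G W f) where

  private
    f-injective : ∀ {i j} → f i ≡ f j → i ≡ j
    f-injective = proj₁ iso

    vertex : ∀ {x} → x ∈ W → ∃[ i ] f i ≡ x
    vertex = proj₁ (proj₂ (proj₂ iso)) _

    adj⇒ : ∀ {i j} → adj G i j ≡ true → Interlaced W (f i) (f j)
    adj⇒ = proj₁ (proj₂ (proj₂ (proj₂ iso)) _ _)

    adj⇐ : ∀ {i j} → Interlaced W (f i) (f j) → adj G i j ≡ true
    adj⇐ = proj₂ (proj₂ (proj₂ (proj₂ iso)) _ _)

    open Chords W W-double using (⨯-letter)

    neighbours : ∀ {v} → v ∈ W → ∃[ L ] length L ≡ 3 × Unique L ×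
      (∀ {t} → Interlaced W v t → t ∈ L) × (∀ {t} → t ∈ L → Interlaced W v t)
    neighbours v∈ with i , refl ← vertex v∈ =
      map f N , trans (length-map f N) (G-cubic i) , map⁺ f-injective (filter⁺ adj? (allFin⁺ n)) , to , from
      where
      adj? = λ j → T? (adj G i j)
      N = filter adj? (allFin n)
      to : ∀ {t} → Interlaced W (f i) t → t ∈ map f N
      to i⨯t with j , refl ← vertex (⨯-letter i⨯t) =
        ∈-map⁺ f (∈-filter⁺ adj? (∈-allFin j) (Equivalence.from T-≡ (adj⇐ i⨯t)))
      from : ∀ {t} → t ∈ map f N → Interlaced W (f i) t
      from t∈ with j , j∈ , refl ← ∈-map⁻ f t∈ =
        adj⇒ (Equivalence.to T-≡ (proj₂ (∈-filter⁻ adj? {xs = allFin n} j∈)))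

    open Cubic W W-double neighbours

    twins : ∀ {i j} → Twin (f i) (f j) → Twins G i j
    twins {i} {j} (fi≢fj , same) = (fi≢fj ∘ cong f) , λ k k≢i k≢j →
      let there-to , back = same (k≢i ∘ f-injective) (k≢j ∘ f-injective) in
      ⇔→≡ {z = true} (mk⇔ (adj⇐ ∘ there-to ∘ adj⇒) (adj⇐ ∘ back ∘ adj⇒))

  cubic-circle-twins : Fin n → TwoDisjointTwinPairs G
  cubic-circle-twins i
    with a , b , c , d , ab , cd , a∈ ∷ b∈ ∷ c∈ ∷ d∈ ∷ [] , a≢c , a≢d , b≢c , b≢d ← twin-pairs (proj₁ (proj₂ iso) i)
    with a′ , refl ← vertex a∈ | b′ , refl ← vertex b∈ | c′ , refl ← vertex c∈ | d′ , refl ← vertex d∈ =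
    a′ , b′ , c′ , d′ , twins ab , twins cd , a≢c ∘ cong f , a≢d ∘ cong f , b≢c ∘ cong f , b≢d ∘ cong f

theorem5 : ∀ (n : ℕ) → 0 < n → (G : SimpleGraph n) → Regular 3 G → CircleGraph G → TwoDisjointTwinPairs G
-- Any vertex will do: its letter shows that the word contains a chord.
theorem5 (suc n) _ G G-cubic (W , W-double , f , iso) = cubic-circle-twins G G-cubic W-double iso zero
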